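{- For every $n>0$, the $M$-triangle of the core label order of the Hochschild lattice $\mathrm{Hoch}(n)$ is $$M_n(x,y)=(xy-y+1)^{n-2}\Bigl((n+1)\bigl((x-1)y-xy^2\bigr)+(n+x^2)y^2+1\Bigr).$$ (For $n=1$ the identity is read in the field of rational functions in $x,y$.)
   Context: Hochschild lattice. For $n\geq 1$, a triword of length $n$ is a tuple $u=(u_1,\ldots,u_n)$ such that (T1) $u_i\in\{0,1,2\}$ for all $i$; (T2) $u_1\neq 2$; (T3) if $u_i=0$, then $u_j\neq 1$ for all $j>i$. Let $\mathrm{Tri}(n)$ be the set of all triwords of length $n$. The Hochschild lattice is $\mathrm{Hoch}(n)=(\mathrm{Tri}(n),\leq)$ where $\leq$ is the componentwise order. It is known to be a semidistributive lattice: the join is the componentwise maximum, and the meet is obtained by taking the componentwise minimum and then replacing by $0$ every entry $1$ that has an entry $0$ somewhere to its left. Core label order. Let $L$ be a finite semidistributive lattice. For a cover relation $a\lessdot b$ put $\lambda(a,b)=\min\{c\in L\mid a\vee c=b\}$; this minimum exists and is join irreducible. The nucleus of $a\in L$ is $a_\downarrow=a\wedge\bigwedge_{b\lessdot a}b$. The core label set of $a$ is $\Psi(a)=\{\lambda(b,b')\mid a_\downarrow\leq b\lessdot b'\leq a\}$. The map $a\mapsto\Psi(a)$ is injective. The core label order $\mathrm{CLO}(L)$ is the poset $(L,\sqsubseteq)$ where $a\sqsubseteq b$ if and only if $\Psi(a)\subseteq\Psi(b)$. $M$-triangle. The poset $\mathrm{CLO}(\mathrm{Hoch}(n))$ is graded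 with least element $(0,\ldots,0)$; let $\mathrm{rk}$ be its rank function (so $\mathrm{rk}(0,\ldots,0)=0$) and $\mu_n$ its Möbius function (with $\mu_n(u,v)=0$ if $u\not\sqsubseteq v$). The $M$-triangle is $$M_n(x,y)=\sum_{u,v\in\mathrm{Tri}(n)}\mu_n(u,v)\,x^{\mathrm{rk}(u)}y^{\mathrm{rk}(v)}.$$ -}

module Defs where

open import Algebra.Bundles using (CommutativeRing)
import Algebra.Properties.Ring
open import Data.Bool.Base using (true; false; if_then_else_)
open import Data.Empty using (⊥-elim)
open import Data.Fin.Base as Fin using (Fin; toℕ)
open import Data.Fin.Patterns using (0F; 1F; 2F)
import Data.Fin.Induction as Fin
import Data.Fin.Properties as Fin
open import Data.Integer.Base as ℤ using (ℤ; 0ℤ; 1ℤ)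
import Data.Integer.Properties as ℤ
open import Data.List.Base as List using (List; []; _∷_; filter; foldr)
import Data.List.Membership.Propositional.Properties as ∈
open import Data.List.Membership.Propositional using (_∈_; lose; find)
open import Data.List.Relation.Unary.Any as Any using (Any; here; there)
import Data.List.Relation.Unary.Any.Properties as Any
open import Data.List.Relation.Unary.AllPairs as AllPairs using ([]; _∷_)
open import Data.List.Relation.Unary.All as All using (All; []; _∷_)
import Data.List.Relation.Unary.All.Properties as All
open import Data.List.Relation.Unary.Unique.Propositional using (Unique)
import Data.List.Relation.Unary.Unique.Propositional.Properties as Unique
open import Data.Nat.Base as ℕ using (ℕ; zero; suc)
import Data.Nat.Properties as ℕ
open import Data.Product.Base using (∃; ∃-syntax; _×_; _,_; proj₁; proj₂)
open import Data.Sum.Base using (_⊎_; inj₁; inj₂; [_,_]′)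
open import Data.Vec.Base as Vec using (Vec; []; _∷_; lookup; tabulate)
import Data.Vec.Properties as Vec
open import Data.Vec.Relation.Binary.Pointwise.Extensional using (Pointwise; ext; Pointwise-≡⇒≡)
open Pointwise using (app)
open import Algebra.Construct.NaturalChoice.Max (Fin.≤-totalOrder 3)
  using (_⊔_; ⊔-sel; x≤x⊔y; x≤y⊔x; ⊔-lub)
open import Algebra.Construct.NaturalChoice.Min (Fin.≤-totalOrder 3)
  using (_⊓_; ⊓-sel; x⊓y≤x; x⊓y≤y; ⊓-glb)
open import Function.Base using (flip; _on_)
open import Induction.WellFounded using (WellFounded; Acc; acc)
import Induction.WellFounded as WF
open import Level using (0ℓ)
open import Relation.Binary.Bundles using (Setoid)
open import Relation.Binary.Core using (Rel)
open import Relation.Binary.Definitions using (Decidable)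
import Relation.Binary.Construct.NonStrictToStrict as Strict
import Relation.Binary.Construct.On as On
open import Relation.Binary.Lattice.Structures using (IsLattice)
open import Relation.Binary.Lattice.Definitions using (Supremum; Infimum)
open import Relation.Binary.Structures using (IsPartialOrder; IsStrictPartialOrder)
open import Relation.Binary.PropositionalEquality
  using (_≡_; _≢_; refl; sym; trans; cong; cong₂; subst; subst₂; isEquivalence)
import Relation.Binary.Reasoning.Setoid
open import Relation.Nullary.Decidable using (Dec; yes; no; map′; _×-dec_; ¬?; _→-dec_; decidable-stable; toWitness; _⊎-dec_; recompute)
open import Relation.Nullary.Negation using (¬_; contradiction)
import Relation.Unary as Unary

------------------------------------------------------------------------
-- The polynomial ring R[X]

-- A polynomial is a list of coefficients, constant term first.  Trailing
-- zeros are allowed, so equality compares coefficients.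

module Polynomial {c ℓ} (R : CommutativeRing c ℓ) where

  open CommutativeRing R
    renaming ( Carrier to A; _≈_ to _≈ᴬ_; _+_ to _+ᴬ_; _*_ to _*ᴬ_; -_ to -ᴬ_
             ; 0# to 0ᴬ; 1# to 1ᴬ; refl to reflᴬ; sym to symᴬ; trans to transᴬ)
    using ( +-cong; +-assoc; +-comm; +-identityˡ; +-identityʳ; -‿inverseˡ; -‿cong
          ; *-cong; *-assoc; *-comm; *-identityˡ; distribˡ; zeroˡ; zeroʳ; ring)
  open Algebra.Properties.Ring ring using (-0#≈0#)

  Poly : Set c
  Poly = List A

  coeff : Poly → ℕ → A
  coeff []      _       = 0ᴬ
  coeff (a ∷ p) zero    = a
  coeff (a ∷ p) (suc k) = coeff p k

  infix 4 _≋_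
  record _≋_ (p q : Poly) : Set ℓ where
    constructor mk
    field coeff-≈ : ∀ k → coeff p k ≈ᴬ coeff q k
  open _≋_ public

  infixl 6 _⊕_
  _⊕_ : Poly → Poly → Poly
  []      ⊕ q       = q
  (a ∷ p) ⊕ []      = a ∷ p
  (a ∷ p) ⊕ (b ∷ q) = (a +ᴬ b) ∷ (p ⊕ q)

  ⊖_ : Poly → Poly
  ⊖_ = List.map -ᴬ_

  infixr 7 _·_
  _·_ : A → Poly → Poly
  a · p = List.map (a *ᴬ_) p

  infixl 7 _⊛_
  _⊛_ : Poly → Poly → Poly
  []      ⊛ q = []
  (a ∷ p) ⊛ q = a · q ⊕ (0ᴬ ∷ p ⊛ q)

  constant : A → Poly
  constant a = a ∷ []

  X : Poly
  X = 0ᴬ ∷ 1ᴬ ∷ []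

  private
    ≋-refl : ∀ {p} → p ≋ p
    ≋-refl = mk λ _ → reflᴬ

    ≋-sym : ∀ {p q} → p ≋ q → q ≋ p
    ≋-sym e = mk λ k → symᴬ (coeff-≈ e k)

    ≋-trans : ∀ {p q r} → p ≋ q → q ≋ r → p ≋ r
    ≋-trans e f = mk λ k → transᴬ (coeff-≈ e k) (coeff-≈ f k)

    ≋-setoid : Setoid c ℓ
    ≋-setoid = record
      { Carrier       = Poly
      ; _≈_           = _≋_
      ; isEquivalence = record { refl = ≋-refl ; sym = ≋-sym ; trans = ≋-trans }
      }

    module ≋ = Relation.Binary.Reasoning.Setoid ≋-setoid

  coeff-⊕ : ∀ p q k → coeff (p ⊕ q) k ≈ᴬ coeff p k +ᴬ coeff q k
  coeff-⊕ []      q       k       = symᴬ (+-identityˡ _)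
  coeff-⊕ (a ∷ p) []      k       = symᴬ (+-identityʳ _)
  coeff-⊕ (a ∷ p) (b ∷ q) zero    = reflᴬ
  coeff-⊕ (a ∷ p) (b ∷ q) (suc k) = coeff-⊕ p q k

  coeff-⊖ : ∀ p k → coeff (⊖ p) k ≈ᴬ -ᴬ coeff p k
  coeff-⊖ []      k       = symᴬ -0#≈0#
  coeff-⊖ (a ∷ p) zero    = reflᴬ
  coeff-⊖ (a ∷ p) (suc k) = coeff-⊖ p k

  coeff-· : ∀ a p k → coeff (a · p) k ≈ᴬ a *ᴬ coeff p k
  coeff-· a []      k       = symᴬ (zeroʳ a)
  coeff-· a (b ∷ p) zero    = reflᴬ
  coeff-· a (b ∷ p) (suc k) = coeff-· a p k

  private
    ∷-cong : ∀ {a b p q} → a ≈ᴬ b → p ≋ q → a ∷ p ≋ b ∷ q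
    ∷-cong a≈b p≋q = mk λ { zero → a≈b ; (suc k) → coeff-≈ p≋q k }

    0∷[] : 0ᴬ ∷ [] ≋ []
    0∷[] = mk λ { zero → reflᴬ ; (suc k) → reflᴬ }

    ⊕-cong : ∀ {p p′ q q′} → p ≋ p′ → q ≋ q′ → p ⊕ q ≋ p′ ⊕ q′
    ⊕-cong {p} {p′} {q} {q′} e f = mk λ k →
      transᴬ (coeff-⊕ p q k)
        (transᴬ (+-cong (coeff-≈ e k) (coeff-≈ f k)) (symᴬ (coeff-⊕ p′ q′ k)))

    ⊕-comm : ∀ p q → p ⊕ q ≋ q ⊕ p
    ⊕-comm p q = mk λ k →
      transᴬ (coeff-⊕ p q k) (transᴬ (+-comm _ _) (symᴬ (coeff-⊕ q p k)))

    ⊕-assoc : ∀ p q r → (p ⊕ q) ⊕ r ≋ p ⊕ (q ⊕ r)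
    ⊕-assoc p q r = mk λ k →
      transᴬ (coeff-⊕ (p ⊕ q) r k)
        (transᴬ (+-cong (coeff-⊕ p q k) reflᴬ)
          (transᴬ (+-assoc _ _ _)
            (symᴬ (transᴬ (coeff-⊕ p (q ⊕ r) k) (+-cong reflᴬ (coeff-⊕ q r k))))))

    ⊕-identityʳ : ∀ p → p ⊕ [] ≋ p
    ⊕-identityʳ p = ⊕-comm p []

    ⊖-cong : ∀ {p q} → p ≋ q → ⊖ p ≋ ⊖ q
    ⊖-cong {p} {q} e = mk λ k →
      transᴬ (coeff-⊖ p k) (transᴬ (-‿cong (coeff-≈ e k)) (symᴬ (coeff-⊖ q k)))

    ⊖-inverseˡ : ∀ p → ⊖ p ⊕ p ≋ []
    ⊖-inverseˡ p = mk λ k →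
      transᴬ (coeff-⊕ (⊖ p) p k)
        (transᴬ (+-cong (coeff-⊖ p k) reflᴬ) (-‿inverseˡ _))

    ·-cong : ∀ {a b p q} → a ≈ᴬ b → p ≋ q → a · p ≋ b · q
    ·-cong {a} {b} {p} {q} e f = mk λ k →
      transᴬ (coeff-· a p k) (transᴬ (*-cong e (coeff-≈ f k)) (symᴬ (coeff-· b q k)))

    ·-⊕ : ∀ a p q → a · (p ⊕ q) ≋ a · p ⊕ a · q
    ·-⊕ a p q = mk λ k →
      transᴬ (coeff-· a (p ⊕ q) k)
        (transᴬ (*-cong reflᴬ (coeff-⊕ p q k))
          (transᴬ (distribˡ _ _ _)
            (symᴬ (transᴬ (coeff-⊕ (a · p) (a · q) k)
                     (+-cong (coeff-· a p k) (coeff-· a q k))))))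

    ·-· : ∀ a b p → a · b · p ≋ (a *ᴬ b) · p
    ·-· a b p = mk λ k →
      transᴬ (coeff-· a (b · p) k)
        (transᴬ (*-cong reflᴬ (coeff-· b p k))
          (transᴬ (symᴬ (*-assoc _ _ _)) (symᴬ (coeff-· (a *ᴬ b) p k))))

    1· : ∀ p → 1ᴬ · p ≋ p
    1· p = mk λ k → transᴬ (coeff-· 1ᴬ p k) (*-identityˡ _)

    0· : ∀ p → 0ᴬ · p ≋ []
    0· p = mk λ k → transᴬ (coeff-· 0ᴬ p k) (zeroˡ _)

    ·-0∷ : ∀ a p → a · (0ᴬ ∷ p) ≋ 0ᴬ ∷ a · p
    ·-0∷ a p = ∷-cong (zeroʳ a) ≋-refl

    0∷-⊕ : ∀ p q → 0ᴬ ∷ (p ⊕ q) ≋ (0ᴬ ∷ p) ⊕ (0ᴬ ∷ q)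
    0∷-⊕ p q = ∷-cong (symᴬ (+-identityˡ 0ᴬ)) ≋-refl

    interchange : ∀ p q r s → (p ⊕ q) ⊕ (r ⊕ s) ≋ (p ⊕ r) ⊕ (q ⊕ s)
    interchange p q r s = begin
      (p ⊕ q) ⊕ (r ⊕ s)  ≈⟨ ⊕-assoc p q (r ⊕ s) ⟩
      p ⊕ (q ⊕ (r ⊕ s))  ≈⟨ ⊕-cong {p} ≋-refl (⊕-assoc q r s) ⟨
      p ⊕ ((q ⊕ r) ⊕ s)  ≈⟨ ⊕-cong {p} ≋-refl (⊕-cong (⊕-comm q r) (≋-refl {s})) ⟩
      p ⊕ ((r ⊕ q) ⊕ s)  ≈⟨ ⊕-cong {p} ≋-refl (⊕-assoc r q s) ⟩
      p ⊕ (r ⊕ (q ⊕ s))  ≈⟨ ⊕-assoc p r (q ⊕ s) ⟨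
      (p ⊕ r) ⊕ (q ⊕ s)  ∎
      where open ≋

    ⊛-congʳ : ∀ p {q r} → q ≋ r → p ⊛ q ≋ p ⊛ r
    ⊛-congʳ []      e = ≋-refl
    ⊛-congʳ (a ∷ p) e = ⊕-cong (·-cong reflᴬ e) (∷-cong reflᴬ (⊛-congʳ p e))

    ⊛-zeroʳ : ∀ p → p ⊛ [] ≋ []
    ⊛-zeroʳ []      = ≋-refl
    ⊛-zeroʳ (a ∷ p) = ≋-trans (∷-cong reflᴬ (⊛-zeroʳ p)) 0∷[]

    ⊛-∷ : ∀ p b q → p ⊛ (b ∷ q) ≋ b · p ⊕ (0ᴬ ∷ p ⊛ q)
    ⊛-∷ []      b q = ≋-sym 0∷[]
    ⊛-∷ (a ∷ p) b q = ∷-cong (+-cong (*-comm a b) reflᴬ) (begin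
      a · q ⊕ p ⊛ (b ∷ q)                ≈⟨ ⊕-cong {a · q} ≋-refl (⊛-∷ p b q) ⟩
      a · q ⊕ (b · p ⊕ (0ᴬ ∷ p ⊛ q))     ≈⟨ ⊕-assoc (a · q) (b · p) _ ⟨
      (a · q ⊕ b · p) ⊕ (0ᴬ ∷ p ⊛ q)     ≈⟨ ⊕-cong (⊕-comm (a · q) (b · p)) ≋-refl ⟩
      (b · p ⊕ a · q) ⊕ (0ᴬ ∷ p ⊛ q)     ≈⟨ ⊕-assoc (b · p) (a · q) _ ⟩
      b · p ⊕ (a · q ⊕ (0ᴬ ∷ p ⊛ q))     ∎)
      where open ≋

    ⊛-comm : ∀ p q → p ⊛ q ≋ q ⊛ p
    ⊛-comm []      q = ≋-sym (⊛-zeroʳ q)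
    ⊛-comm (a ∷ p) q = begin
      a · q ⊕ (0ᴬ ∷ p ⊛ q)  ≈⟨ ⊕-cong {a · q} ≋-refl (∷-cong reflᴬ (⊛-comm p q)) ⟩
      a · q ⊕ (0ᴬ ∷ q ⊛ p)  ≈⟨ ⊛-∷ q a p ⟨
      q ⊛ (a ∷ p)           ∎
      where open ≋

    ⊛-cong : ∀ {p p′ q q′} → p ≋ p′ → q ≋ q′ → p ⊛ q ≋ p′ ⊛ q′
    ⊛-cong {p} {p′} {q} {q′} e f = begin
      p ⊛ q    ≈⟨ ⊛-congʳ p f ⟩
      p ⊛ q′   ≈⟨ ⊛-comm p q′ ⟩
      q′ ⊛ p   ≈⟨ ⊛-congʳ q′ e ⟩
      q′ ⊛ p′  ≈⟨ ⊛-comm q′ p′ ⟩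
      p′ ⊛ q′  ∎
      where open ≋

    ⊛-distribˡ : ∀ p q r → p ⊛ (q ⊕ r) ≋ p ⊛ q ⊕ p ⊛ r
    ⊛-distribˡ []      q r = ≋-refl
    ⊛-distribˡ (a ∷ p) q r = begin
      a · (q ⊕ r) ⊕ (0ᴬ ∷ p ⊛ (q ⊕ r))
        ≈⟨ ⊕-cong (·-⊕ a q r)
             (≋-trans (∷-cong reflᴬ (⊛-distribˡ p q r)) (0∷-⊕ (p ⊛ q) (p ⊛ r))) ⟩
      (a · q ⊕ a · r) ⊕ ((0ᴬ ∷ p ⊛ q) ⊕ (0ᴬ ∷ p ⊛ r))
        ≈⟨ interchange (a · q) (a · r) _ _ ⟩
      (a · q ⊕ (0ᴬ ∷ p ⊛ q)) ⊕ (a · r ⊕ (0ᴬ ∷ p ⊛ r)) ∎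
      where open ≋

    ⊛-distribʳ : ∀ p q r → (q ⊕ r) ⊛ p ≋ q ⊛ p ⊕ r ⊛ p
    ⊛-distribʳ p q r = begin
      (q ⊕ r) ⊛ p    ≈⟨ ⊛-comm (q ⊕ r) p ⟩
      p ⊛ (q ⊕ r)    ≈⟨ ⊛-distribˡ p q r ⟩
      p ⊛ q ⊕ p ⊛ r  ≈⟨ ⊕-cong (⊛-comm p q) (⊛-comm p r) ⟩
      q ⊛ p ⊕ r ⊛ p  ∎
      where open ≋

    ·-⊛ : ∀ a p q → (a · p) ⊛ q ≋ a · (p ⊛ q)
    ·-⊛ a []      q = ≋-refl
    ·-⊛ a (b ∷ p) q = begin
      (a *ᴬ b) · q ⊕ (0ᴬ ∷ (a · p) ⊛ q)
        ≈⟨ ⊕-cong (≋-sym (·-· a b q))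
             (≋-trans (∷-cong reflᴬ (·-⊛ a p q)) (≋-sym (·-0∷ a (p ⊛ q)))) ⟩
      a · b · q ⊕ a · (0ᴬ ∷ p ⊛ q)
        ≈⟨ ·-⊕ a (b · q) (0ᴬ ∷ p ⊛ q) ⟨
      a · (b · q ⊕ (0ᴬ ∷ p ⊛ q)) ∎
      where open ≋

    ⊛-assoc : ∀ p q r → (p ⊛ q) ⊛ r ≋ p ⊛ (q ⊛ r)
    ⊛-assoc []      q r = ≋-refl
    ⊛-assoc (a ∷ p) q r = begin
      (a · q ⊕ (0ᴬ ∷ p ⊛ q)) ⊛ r
        ≈⟨ ⊛-distribʳ r (a · q) (0ᴬ ∷ p ⊛ q) ⟩
      (a · q) ⊛ r ⊕ (0ᴬ · r ⊕ (0ᴬ ∷ (p ⊛ q) ⊛ r))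
        ≈⟨ ⊕-cong (·-⊛ a q r) (⊕-cong (0· r) (∷-cong reflᴬ (⊛-assoc p q r))) ⟩
      a · (q ⊛ r) ⊕ (0ᴬ ∷ p ⊛ (q ⊛ r)) ∎
      where open ≋

    ⊛-identityˡ : ∀ p → constant 1ᴬ ⊛ p ≋ p
    ⊛-identityˡ p = begin
      1ᴬ · p ⊕ (0ᴬ ∷ [])  ≈⟨ ⊕-cong (1· p) 0∷[] ⟩
      p ⊕ []              ≈⟨ ⊕-identityʳ p ⟩
      p                   ∎
      where open ≋

  commutativeRing : CommutativeRing c ℓ
  commutativeRing = record
    { Carrier = Poly
    ; _≈_     = _≋_
    ; _+_     = _⊕_
    ; _*_     = _⊛_
    ; -_      = ⊖_
    ; 0#      = []
    ; 1#      = constant 1ᴬ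
    ; isCommutativeRing = record
      { isRing = record
        { +-isAbelianGroup = record
          { isGroup = record
            { isMonoid = record
              { isSemigroup = record
                { isMagma = record
                  { isEquivalence = Setoid.isEquivalence ≋-setoid
                  ; ∙-cong        = ⊕-cong
                  }
                ; assoc = ⊕-assoc
                }
              ; identity = (λ _ → ≋-refl) , ⊕-identityʳ
              }
            ; inverse = ⊖-inverseˡ , λ p → ≋-trans (⊕-comm p (⊖ p)) (⊖-inverseˡ p)
            ; ⁻¹-cong = ⊖-cong
            }
          ; comm = ⊕-comm
          }
        ; *-cong     = ⊛-cong
        ; *-assoc    = ⊛-assoc
        ; *-identity = ⊛-identityˡ
                     , λ p → ≋-trans (⊛-comm p (constant 1ᴬ)) (⊛-identityˡ p)
        ; distrib    = ⊛-distribˡ , ⊛-distribʳ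
        }
      ; *-comm = ⊛-comm
      }
    }

module ℤ[x]   = Polynomial ℤ.+-*-commutativeRing
module ℤ[x,y] = Polynomial ℤ[x].commutativeRing

ℤ[x,y]-ring : CommutativeRing _ _
ℤ[x,y]-ring = ℤ[x,y].commutativeRing

------------------------------------------------------------------------
-- Finite types

record Finite (A : Set) : Set where
  field
    elements : List A
    complete : ∀ a → a ∈ elements
    unique   : Unique elements

  ∃? : ∀ {P : A → Set} → Unary.Decidable P → Dec (∃ P)
  ∃? P? = map′ (λ p → let a , _ , pa = find p in a , pa)
               (λ (a , pa) → lose (complete a) pa)
               (Any.any? P? elements)

  ∀? : ∀ {P : A → Set} → Unary.Decidable P → Dec (∀ a → P a)
  ∀? P? = map′ (λ ps a → All.lookup ps (complete a))
               (λ f → All.tabulate λ {a} _ → f a)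
               (All.all? P? elements)

  wellFounded : {_<_ : Rel A 0ℓ} → IsStrictPartialOrder _≡_ _<_ → WellFounded _<_
  wellFounded {_<_} spo =
    WF.Subrelation.wellFounded
      (λ {a} {b} a<b → subst₂ _<_ (Any.lookup-index (complete a)) (Any.lookup-index (complete b)) a<b)
      (On.wellFounded index (Fin.spo-wellFounded (On.isStrictPartialOrder (List.lookup elements) spo)))
    where
    index : A → Fin _
    index a = Any.index (complete a)

------------------------------------------------------------------------
-- Finite posets

record FinitePoset : Set₁ where
  infix 4 _≤_ _≤?_
  field
    Carrier        : Set
    _≤_            : Rel Carrier 0ℓ
    isPartialOrder : IsPartialOrder _≡_ _≤_
    _≤?_           : Decidable _≤_
    finite         : Finite Carrier

  open Finite finite public
  open IsPartialOrder isPartialOrder public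
    using (antisym)
    renaming (refl to ≤-refl; reflexive to ≤-reflexive; trans to ≤-trans)

  infix 4 _≟_ _<_ _<?_ _⋖_ _⋖?_

  _≟_ : Decidable {A = Carrier} _≡_
  a ≟ b = map′ (λ (p , q) → antisym p q) (λ { refl → ≤-refl , ≤-refl }) (a ≤? b ×-dec b ≤? a)

  _<_ : Rel Carrier 0ℓ
  _<_ = Strict._<_ _≡_ _≤_

  _<?_ : Decidable _<_
  _<?_ = Strict.<-decidable _≡_ _≤_ _≟_ _≤?_

  <-isStrictPartialOrder : IsStrictPartialOrder _≡_ _<_
  <-isStrictPartialOrder = Strict.<-isStrictPartialOrder _≡_ _≤_ isPartialOrder

  <-wellFounded : WellFounded _<_
  <-wellFounded = wellFounded <-isStrictPartialOrder

  _⋖_ : Rel Carrier 0ℓ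
  a ⋖ b = a < b × ∀ c → ¬ (a < c × c < b)

  _⋖?_ : Decidable _⋖_
  a ⋖? b = a <? b ×-dec ∀? (λ c → ¬? (a <? c ×-dec c <? b))

  below-lower-cover : ∀ {a b} → a < b → ∃[ p ] (a ≤ p × p ⋖ b)
  below-lower-cover {a} {b} = go a (>-wellFounded a)
    where
    module < = IsStrictPartialOrder <-isStrictPartialOrder

    >-wellFounded : WellFounded (flip _<_)
    >-wellFounded = wellFounded record
      { isEquivalence = isEquivalence
      ; irrefl        = λ { refl → <.irrefl refl }
      ; trans         = λ p q → <.trans q p
      ; <-resp-≈      = (λ { refl p → p }) , (λ { refl p → p })
      }

    go : ∀ a → Acc (flip _<_) a → a < b → ∃[ p ] (a ≤ p × p ⋖ b)
    go a (acc rs) a<b with ∃? (λ c → a <? c ×-dec c <? b)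
    ... | no  ∄c                = a , ≤-refl , a<b , λ c between → ∄c (c , between)
    ... | yes (c , a<c , c<b) with p , c≤p , p⋖b ← go c (rs a<c) c<b =
      p , ≤-trans (proj₁ a<c) c≤p , p⋖b

  ∑ : (Carrier → ℤ) → ℤ
  ∑ f = foldr ℤ._+_ 0ℤ (List.map f elements)

  -- The Möbius function is defined by recursion on its second argument:
  -- μ(a,a) = 1, μ(a,b) = -∑ μ(a,c) over a ≤ c < b when a < b, and
  -- μ(a,b) = 0 otherwise.

  private
    term : ∀ {a b c} → Dec (a ≤ c) → Dec (c < b) → (c < b → ℤ) → ℤ
    term (yes _) (yes c<b) f = f c<b
    term (yes _) (no  _)   f = 0ℤ
    term (no  _) _         f = 0ℤ

    cases : ∀ {a b} → Dec (a ≡ b) → Dec (a ≤ b) → ℤ → ℤ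
    cases (yes _) _       s = 1ℤ
    cases (no  _) (yes _) s = ℤ.- s
    cases (no  _) (no  _) s = 0ℤ

    step : ∀ a b → (∀ {c} → c < b → ℤ) → ℤ
    step a b rec = cases (a ≟ b) (a ≤? b) (∑ λ c → term (a ≤? c) (c <? b) rec)

    ∑-cong : ∀ {f g} → (∀ c → f c ≡ g c) → ∑ f ≡ ∑ g
    ∑-cong {f} {g} f≗g = go elements
      where
      go : ∀ cs → foldr ℤ._+_ 0ℤ (List.map f cs) ≡ foldr ℤ._+_ 0ℤ (List.map g cs)
      go []       = refl
      go (c ∷ cs) = cong₂ ℤ._+_ (f≗g c) (go cs)

    step-cong : ∀ a b {f g : ∀ {c} → c < b → ℤ} →
                (∀ {c} (c<b : c < b) → f c<b ≡ g c<b) → step a b f ≡ step a b g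
    step-cong a b {f} {g} f≗g =
      cong (cases (a ≟ b) (a ≤? b)) (∑-cong λ c → term-cong (a ≤? c) (c <? b))
      where
      term-cong : ∀ {c} (p : Dec (a ≤ c)) (q : Dec (c < b)) → term p q f ≡ term p q g
      term-cong (yes _) (yes c<b) = f≗g c<b
      term-cong (yes _) (no  _)   = refl
      term-cong (no  _) _         = refl

  μ : Carrier → Carrier → ℤ
  μ a = WF.All.wfRec <-wellFounded _ (λ _ → ℤ) (step a)

  private
    μ-unfold : ∀ a b → μ a b ≡ step a b (λ {c} _ → μ a c)
    μ-unfold a b = WF.FixPoint.unfold-wfRec <-wellFounded (λ _ → ℤ) (step a) (step-cong a)

  μ-refl : ∀ a → μ a a ≡ 1ℤ
  μ-refl a = trans (μ-unfold a a) (go (a ≟ a))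
    where
    go : ∀ {q s} (p : Dec (a ≡ a)) → cases p q s ≡ 1ℤ
    go (yes _)   = refl
    go (no  a≢a) = contradiction refl a≢a

  μ-≰ : ∀ {a b} → ¬ a ≤ b → μ a b ≡ 0ℤ
  μ-≰ {a} {b} a≰b = trans (μ-unfold a b) (go (a ≟ b) (a ≤? b))
    where
    go : ∀ {s} (p : Dec (a ≡ b)) (q : Dec (a ≤ b)) → cases p q s ≡ 0ℤ
    go (yes a≡b) _         = contradiction (≤-reflexive a≡b) a≰b
    go (no  _)   (yes a≤b) = contradiction a≤b a≰b
    go (no  _)   (no  _)   = refl

  μ-< : ∀ {a b} → a < b →
        μ a b ≡ ℤ.- foldr ℤ._+_ 0ℤ
                      (List.map (μ a) (filter (λ c → a ≤? c ×-dec c <? b) elements))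
  μ-< {a} {b} a<b = trans (μ-unfold a b)
    (trans (go (a ≟ b) (a ≤? b)) (cong ℤ.-_ (sums elements)))
    where
    go : ∀ {s} (p : Dec (a ≡ b)) (q : Dec (a ≤ b)) → cases p q s ≡ ℤ.- s
    go (yes a≡b) _         = contradiction a≡b (proj₂ a<b)
    go (no  _)   (yes _)   = refl
    go (no  _)   (no  a≰b) = contradiction (proj₁ a<b) a≰b

    between? : Unary.Decidable (λ c → a ≤ c × c < b)
    between? c = a ≤? c ×-dec c <? b

    value : ∀ {c} (p : Dec (a ≤ c)) (q : Dec (c < b)) → (p ×-dec q) .Dec.does ≡ true →
            term p q (λ _ → μ a c) ≡ μ a c
    value (yes _) (yes _) _ = refl

    vanish : ∀ {c} (p : Dec (a ≤ c)) (q : Dec (c < b)) → (p ×-dec q) .Dec.does ≡ false →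
             term p q (λ _ → μ a c) ≡ 0ℤ
    vanish (yes _) (no  _) _ = refl
    vanish (no  _) _       _ = refl

    sums : ∀ cs →
      foldr ℤ._+_ 0ℤ (List.map (λ c → term (a ≤? c) (c <? b) (λ _ → μ a c)) cs)
      ≡ foldr ℤ._+_ 0ℤ (List.map (μ a) (filter between? cs))
    sums []       = refl
    sums (c ∷ cs) with between? c .Dec.does in e
    ... | true  = cong₂ ℤ._+_ (value (a ≤? c) (c <? b) e) (sums cs)
    ... | false = trans (cong₂ ℤ._+_ (vanish (a ≤? c) (c <? b) e) (sums cs)) (ℤ.+-identityˡ _)

record IsRankFunction (P : FinitePoset) (rk : FinitePoset.Carrier P → ℕ) : Set where
  open FinitePoset P
  field
    least : ∀ a → (∀ b → a ≤ b) → rk a ≡ 0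
    cover : ∀ a b → a ⋖ b → rk b ≡ suc (rk a)

------------------------------------------------------------------------
-- Finite semidistributive lattices and the core label order

record FiniteSemidistributiveLattice : Set₁ where
  infixr 6 _∨_
  infixr 7 _∧_
  field
    finitePoset : FinitePoset

  open FinitePoset finitePoset public

  field
    _∨_ _∧_             : Carrier → Carrier → Carrier
    isLattice           : IsLattice _≡_ _≤_ _∨_ _∧_
    ∨-semidistributive  : ∀ a b c → a ∨ b ≡ a ∨ c → a ∨ (b ∧ c) ≡ a ∨ b
    ∧-semidistributive  : ∀ a b c → a ∧ b ≡ a ∧ c → a ∧ (b ∨ c) ≡ a ∧ b

  open IsLattice isLattice public
    using (x≤x∨y; y≤x∨y; ∨-least; x∧y≤x; x∧y≤y; ∧-greatest)

  ⋀ : List Carrier → Carrier → Carrier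
  ⋀ as b = foldr _∧_ b as

  nucleus : Carrier → Carrier
  nucleus a = ⋀ (filter (_⋖? a) elements) a

  -- c = λ(a,b), the least element of { d | a ∨ d = b }.
  IsLabel : Carrier → Carrier → Carrier → Set
  IsLabel a b c = a ∨ c ≡ b × ∀ d → a ∨ d ≡ b → c ≤ d

  Ψ : Carrier → Carrier → Set
  Ψ a c = ∃[ b ] ∃[ b′ ] (nucleus a ≤ b × b ⋖ b′ × b′ ≤ a × IsLabel b b′ c)

  infix 4 _⊑_
  _⊑_ : Rel Carrier 0ℓ
  a ⊑ b = Ψ a Unary.⊆ Ψ b

  isLabel? : ∀ a b c → Dec (IsLabel a b c)
  isLabel? a b c = a ∨ c ≟ b ×-dec ∀? λ d → (a ∨ d ≟ b) →-dec (c ≤? d)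

  Ψ? : ∀ a c → Dec (Ψ a c)
  Ψ? a c = ∃? λ b → ∃? λ b′ →
    nucleus a ≤? b ×-dec b ⋖? b′ ×-dec b′ ≤? a ×-dec isLabel? b b′ c

  _⊑?_ : Decidable _⊑_
  a ⊑? b = map′ (λ f {c} → f c) (λ f c → f) (∀? λ c → Ψ? a c →-dec Ψ? b c)

  private
    ∨-absorbs : ∀ {a b} → a ≤ b → a ∨ b ≡ b
    ∨-absorbs a≤b = antisym (∨-least a≤b ≤-refl) (y≤x∨y _ _)

    ⋀-lower : ∀ as {b c} → c ∈ as → ⋀ as b ≤ c
    ⋀-lower (a ∷ as) (here refl) = x∧y≤x _ _
    ⋀-lower (a ∷ as) (there c∈)  = ≤-trans (x∧y≤y _ _) (⋀-lower as c∈)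

  label-exists : ∀ {a b} → a ≤ b → ∃ (IsLabel a b)
  label-exists {a} {b} a≤b =
    ⋀ ds b , solves ds (All.all-filter solves? elements) , λ d a∨d≡b → ⋀-lower ds (∈.∈-filter⁺ solves? (complete d) a∨d≡b)
    where
    solves? : Unary.Decidable (λ d → a ∨ d ≡ b)
    solves? d = a ∨ d ≟ b
    ds = filter solves? elements
    solves : ∀ es → All (λ d → a ∨ d ≡ b) es → a ∨ ⋀ es b ≡ b
    solves []       []       = ∨-absorbs a≤b
    solves (e ∷ es) (p ∷ ps) =
      trans (∨-semidistributive a e (⋀ es b) (trans p (sym (solves es ps)))) p

  nucleus-lower : ∀ {a p} → p ⋖ a → nucleus a ≤ p
  nucleus-lower {a} {p} p⋖a = ⋀-lower _ (∈.∈-filter⁺ (_⋖? a) (complete p) p⋖a)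

  ⊑⇒≤ : ∀ {a b} → a ⊑ b → a ≤ b
  ⊑⇒≤ {a} {b} a⊑b = decidable-stable (a ≤? b) λ a≰b →
    let p , a∧b≤p , p⋖a = below-lower-cover
          (x∧y≤x a b , λ a∧b≡a → a≰b (subst (_≤ b) a∧b≡a (x∧y≤y a b)))
        (p≤a , p≢a) , _ = p⋖a
        c , isLabel = label-exists p≤a
        p∨c≡a , _ = isLabel
        _ , b′ , _ , _ , b′≤b , b″∨c≡b′ , _ = a⊑b (p , a , nucleus-lower p⋖a , p⋖a , ≤-refl , isLabel)
        c≤a = subst (c ≤_) p∨c≡a (y≤x∨y p c)
        c≤b = ≤-trans (subst (c ≤_) b″∨c≡b′ (y≤x∨y _ c)) b′≤b
        c≤p = ≤-trans (∧-greatest c≤a c≤b) a∧b≤p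
    in p≢a (antisym p≤a (subst (_≤ p) p∨c≡a (∨-least ≤-refl c≤p)))

CLO : FiniteSemidistributiveLattice → FinitePoset
CLO L = record
  { Carrier        = Carrier
  ; _≤_            = _⊑_
  ; isPartialOrder = record
    { isPreorder = record
      { isEquivalence = isEquivalence
      ; reflexive     = λ { refl c∈ → c∈ }
      ; trans         = λ a⊑b b⊑c c∈ → b⊑c (a⊑b c∈)
      }
    ; antisym = λ a⊑b b⊑a → antisym (⊑⇒≤ a⊑b) (⊑⇒≤ b⊑a)
    }
  ; _≤?_           = _⊑?_
  ; finite         = finite
  }
  where open FiniteSemidistributiveLattice L

------------------------------------------------------------------------
-- The Hochschild lattice

record IsTriword {n} (u : Vec (Fin 3) n) : Set where
  field
    T2 : ∀ {i} → toℕ i ≡ 0 → lookup u i ≢ 2F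
    T3 : ∀ {i j} → i Fin.< j → lookup u i ≡ 0F → lookup u j ≢ 1F

-- The proof is irrelevant, so triwords are equal when their words are.
record Triword (n : ℕ) : Set where
  constructor ⟨_,_⟩
  field
    word   : Vec (Fin 3) n
    .valid : IsTriword word
open Triword public

isTriword? : ∀ {n} (u : Vec (Fin 3) n) → Dec (IsTriword u)
isTriword? u = map′
  (λ (t2 , t3) → record { T2 = λ {i} → t2 i ; T3 = λ {i} {j} → t3 i j })
  (λ t → (λ i → IsTriword.T2 t) , (λ i j → IsTriword.T3 t))
  (Fin.all? (λ i → (toℕ i ℕ.≟ 0) →-dec ¬? (lookup u i Fin.≟ 2F))
   ×-dec
   Fin.all? (λ i → Fin.all? λ j →
     (i Fin.<? j) →-dec ((lookup u i Fin.≟ 0F) →-dec ¬? (lookup u j Fin.≟ 1F))))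

isTriword : ∀ {n} (u : Triword n) → IsTriword (word u)
isTriword ⟨ u , t ⟩ = recompute (isTriword? u) t

module _ where
  private
    words : ∀ n → List (Vec (Fin 3) n)
    words zero    = [] ∷ []
    words (suc n) = List.cartesianProductWith _∷_ (List.allFin 3) (words n)

    ∈-words : ∀ {n} (u : Vec (Fin 3) n) → u ∈ words n
    ∈-words []      = here refl
    ∈-words (a ∷ u) = ∈.∈-cartesianProductWith⁺ _∷_ (∈.∈-allFin a) (∈-words u)

    words-unique : ∀ n → Unique (words n)
    words-unique zero    = All.[] ∷ []
    words-unique (suc n) =
      Unique.cartesianProductWith⁺ _∷_ (λ { refl → refl , refl }) (Unique.allFin⁺ 3) (words-unique n)

    select : ∀ {n} → List (Vec (Fin 3) n) → List (Triword n)
    select []       = []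
    select (u ∷ us) with isTriword? u
    ... | yes t = ⟨ u , t ⟩ ∷ select us
    ... | no  _ = select us

    ∈-select⁺ : ∀ {n us} {u : Triword n} → word u ∈ us → u ∈ select us
    ∈-select⁺ {us = v ∷ us} {u} u∈ with isTriword? v | u∈
    ... | yes _ | here refl = here refl
    ... | yes _ | there u∈′ = there (∈-select⁺ u∈′)
    ... | no ¬t | here refl = contradiction (isTriword u) ¬t
    ... | no _  | there u∈′ = ∈-select⁺ u∈′

    ∈-select⁻ : ∀ {n us} {u : Triword n} → u ∈ select us → word u ∈ us
    ∈-select⁻ {us = v ∷ us} u∈ with isTriword? v | u∈
    ... | yes _ | here refl = here refl
    ... | yes _ | there u∈′ = there (∈-select⁻ u∈′)
    ... | no _  | u∈′       = there (∈-select⁻ u∈′)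

    select-unique : ∀ {n} {us : List (Vec (Fin 3) n)} → Unique us → Unique (select us)
    select-unique {us = []}     []          = []
    select-unique {us = u ∷ us} (u∉ ∷ uniq) with isTriword? u
    ... | yes _ = All.tabulate (λ v∈ e → All.lookup u∉ (∈-select⁻ v∈) (cong word e))
                  ∷ select-unique uniq
    ... | no  _ = select-unique uniq

  finite-Triword : ∀ n → Finite (Triword n)
  finite-Triword n = record
    { elements = select (words n)
    ; complete = λ u → ∈-select⁺ (∈-words (word u))
    ; unique   = select-unique (words-unique n)
    }

Tri-poset : ℕ → FinitePoset
Tri-poset n = record
  { Carrier        = Triword n
  ; _≤_            = Pointwise Fin._≤_ on word
  ; isPartialOrder = record
    { isPreorder = record
      { isEquivalence = isEquivalence
      ; reflexive     = λ { refl → ext λ i → Fin.≤-refl }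
      ; trans         = λ (ext p) (ext q) → ext λ i → Fin.≤-trans (p i) (q i)
      }
    ; antisym = λ {u} {v} (ext p) (ext q) →
        word-injective (Pointwise-≡⇒≡ (ext λ i → Fin.≤-antisym (p i) (q i)))
    }
  ; _≤?_           = λ u v → map′ ext app (Fin.all? λ i → lookup (word u) i Fin.≤? lookup (word v) i)
  ; finite         = finite-Triword n
  }
  where
  word-injective : ∀ {u v : Triword n} → word u ≡ word v → u ≡ v
  word-injective refl = refl

module TriwordLattice {n : ℕ} where

  open FinitePoset (Tri-poset n)

  _⊔ʷ_ _⊓ʷ_ : Vec (Fin 3) n → Vec (Fin 3) n → Vec (Fin 3) n
  _⊔ʷ_ = Vec.zipWith _⊔_
  _⊓ʷ_ = Vec.zipWith _⊓_

  Reset : Vec (Fin 3) n → Fin n → Set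
  Reset u i = lookup u i ≡ 1F × ∃[ j ] (j Fin.< i × lookup u j ≡ 0F)

  reset? : ∀ u i → Dec (Reset u i)
  reset? u i = lookup u i Fin.≟ 1F ×-dec Fin.any? λ j → j Fin.<? i ×-dec lookup u j Fin.≟ 0F

  reset : Vec (Fin 3) n → Vec (Fin 3) n
  reset u = tabulate λ i → if reset? u i .Dec.does then 0F else lookup u i

  data ResetView (u : Vec (Fin 3) n) (i : Fin n) : Set where
    cleared : Reset u i → lookup (reset u) i ≡ 0F → ResetView u i
    kept    : ¬ Reset u i → lookup (reset u) i ≡ lookup u i → ResetView u i

  resetView : ∀ u i → ResetView u i
  resetView u i with reset? u i in eq | Vec.lookup∘tabulate (λ i → if reset? u i .Dec.does then 0F else lookup u i) i
  ... | yes r | e = cleared r (trans e (cong (λ d → if d .Dec.does then 0F else lookup u i) eq))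
  ... | no ¬r | e = kept ¬r (trans e (cong (λ d → if d .Dec.does then 0F else lookup u i) eq))

  lookup-⊔ : ∀ i u v → lookup (u ⊔ʷ v) i ≡ lookup u i ⊔ lookup v i
  lookup-⊔ = Vec.lookup-zipWith _⊔_

  lookup-⊓ : ∀ i u v → lookup (u ⊓ʷ v) i ≡ lookup u i ⊓ lookup v i
  lookup-⊓ = Vec.lookup-zipWith _⊓_

  ⊔-zero : ∀ a b → a ⊔ b ≡ 0F → a ≡ 0F × b ≡ 0F
  ⊔-zero a b a⊔b≡0 =
      ≤0 (subst (a Fin.≤_) a⊔b≡0 (x≤x⊔y a b))
    , ≤0 (subst (b Fin.≤_) a⊔b≡0 (x≤y⊔x a b))
    where
    ≤0 : ∀ {c : Fin 3} → c Fin.≤ Fin.zero {2} → c ≡ 0F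
    ≤0 {0F} _ = refl

  ⊔-isTriword : ∀ {u v} → IsTriword u → IsTriword v → IsTriword (u ⊔ʷ v)
  ⊔-isTriword {u} {v} tu tv = record
    { T2 = λ {i} i≡0 e → [ (λ s → U.T2 i≡0 (trans (sym s) (trans (sym (lookup-⊔ i u v)) e)))
                         , (λ s → V.T2 i≡0 (trans (sym s) (trans (sym (lookup-⊔ i u v)) e))) ]′
                         (⊔-sel (lookup u i) (lookup v i))
    ; T3 = λ {i} {j} i<j e₀ e₁ →
        let u₀ , v₀ = ⊔-zero _ _ (trans (sym (lookup-⊔ i u v)) e₀)
        in [ (λ s → U.T3 i<j u₀ (trans (sym s) (trans (sym (lookup-⊔ j u v)) e₁)))
           , (λ s → V.T3 i<j v₀ (trans (sym s) (trans (sym (lookup-⊔ j u v)) e₁))) ]′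
           (⊔-sel (lookup u j) (lookup v j))
    }
    where
    module U = IsTriword tu
    module V = IsTriword tv

  reset-T3 : ∀ u {i j} → i Fin.< j → lookup (reset u) i ≡ 0F → lookup (reset u) j ≢ 1F
  reset-T3 u {i} {j} i<j e₀ e₁ with resetView u j
  ... | cleared _ e = Fin.0≢1+n (trans (sym e) e₁)
  ... | kept ¬r e with resetView u i
  ... | cleared (_ , k , k<i , z) _ = ¬r (trans (sym e) e₁ , k , Fin.<-trans k<i i<j , z)
  ... | kept _ e′                   = ¬r (trans (sym e) e₁ , i , i<j , trans (sym e′) e₀)

  reset-≤ : ∀ u i → lookup (reset u) i Fin.≤ lookup u i
  reset-≤ u i with resetView u i
  ... | cleared _ e = subst (Fin._≤ lookup u i) (sym e) ℕ.z≤n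
  ... | kept _ e    = Fin.≤-reflexive e

  ⊓-isTriword : ∀ {u v} → IsTriword u → IsTriword (reset (u ⊓ʷ v))
  ⊓-isTriword {u} {v} tu = record
    { T2 = λ {i} i≡0 e → IsTriword.T2 tu i≡0 (two-max (subst (Fin._≤ lookup u i) e
             (Fin.≤-trans (reset-≤ (u ⊓ʷ v) i)
               (subst (Fin._≤ lookup u i) (sym (lookup-⊓ i u v)) (x⊓y≤x (lookup u i) (lookup v i))))))
    ; T3 = reset-T3 (u ⊓ʷ v)
    }
    where
    two-max : ∀ {a : Fin 3} → Fin.suc (Fin.suc (Fin.zero {0})) Fin.≤ a → a ≡ 2F
    two-max {1F} (ℕ.s≤s ())
    two-max {2F} _ = refl

  ≤0⇒≡0 : ∀ {a : Fin 3} → a Fin.≤ Fin.zero {2} → a ≡ 0F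
  ≤0⇒≡0 {0F} _ = refl

  ⊔-⊓-letters : ∀ (a b c : Fin 3) → a ⊔ b ≡ a ⊔ c → a ⊔ (b ⊓ c) ≡ a ⊔ b
  ⊔-⊓-letters = toWitness {a? = Fin.all? λ a → Fin.all? λ b → Fin.all? λ c →
    (a ⊔ b Fin.≟ a ⊔ c) →-dec (a ⊔ (b ⊓ c) Fin.≟ a ⊔ b)} _

  ⊔-⊓-ones : ∀ (a b c : Fin 3) → b ⊓ c ≡ 1F → a ⊔ b ≡ a ⊔ c →
             (b ≡ 1F × c ≡ 1F) ⊎ (a ⊔ 0F ≡ a ⊔ b)
  ⊔-⊓-ones = toWitness {a? = Fin.all? λ a → Fin.all? λ b → Fin.all? λ c →
    (b ⊓ c Fin.≟ 1F) →-dec ((a ⊔ b Fin.≟ a ⊔ c) →-dec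
      ((b Fin.≟ 1F ×-dec c Fin.≟ 1F) ⊎-dec (a ⊔ 0F Fin.≟ a ⊔ b)))} _

  ⊓-⊔-distrib : ∀ (a b c : Fin 3) → a ⊓ (b ⊔ c) ≡ (a ⊓ b) ⊔ (a ⊓ c)
  ⊓-⊔-distrib = toWitness {a? = Fin.all? λ a → Fin.all? λ b → Fin.all? λ c →
    a ⊓ (b ⊔ c) Fin.≟ (a ⊓ b) ⊔ (a ⊓ c)} _

  reset-zero : ∀ u i → lookup u i ≡ 0F → lookup (reset u) i ≡ 0F
  reset-zero u i e = ≤0⇒≡0 (subst (lookup (reset u) i Fin.≤_) e (reset-≤ u i))

  common-zero : ∀ p q → reset p ≡ reset q → ∀ i → Acc Fin._<_ i → lookup (reset p) i ≡ 0F →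
                ∃[ k ] (k Fin.≤ i × lookup p k ≡ 0F × lookup q k ≡ 0F)
  common-zero p q h i (acc rs) e with resetView p i
  ... | cleared (_ , k , k<i , pₖ) _
    with l , l≤k , pₗ , qₗ ← common-zero p q h k (rs k<i) (reset-zero p k pₖ) =
    l , ℕ.≤-trans l≤k (ℕ.<⇒≤ k<i) , pₗ , qₗ
  ... | kept _ eᵖ with resetView q i
  ... | cleared (_ , k , k<i , qₖ) _
    with l , l≤k , pₗ , qₗ ← common-zero p q h k (rs k<i)
           (trans (cong (λ w → lookup w k) h) (reset-zero q k qₖ)) =
    l , ℕ.≤-trans l≤k (ℕ.<⇒≤ k<i) , pₗ , qₗ
  ... | kept _ eᑫ =
    i , Fin.≤-refl , trans (sym eᵖ) e ,
    trans (sym eᑫ) (trans (sym (cong (λ w → lookup w i) h)) e)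

  infixr 6 _∨_
  infixr 7 _∧_

  _∨_ : Triword n → Triword n → Triword n
  u ∨ v = ⟨ word u ⊔ʷ word v , ⊔-isTriword (isTriword u) (isTriword v) ⟩

  _∧_ : Triword n → Triword n → Triword n
  u ∧ v = ⟨ reset (word u ⊓ʷ word v) , ⊓-isTriword (isTriword u) ⟩

  ∨-supremum : Supremum _≤_ _∨_
  ∨-supremum u v =
      ext (λ i → subst (lookup (word u) i Fin.≤_) (sym (lookup-⊔ i (word u) (word v)))
                   (x≤x⊔y (lookup (word u) i) (lookup (word v) i)))
    , ext (λ i → subst (lookup (word v) i Fin.≤_) (sym (lookup-⊔ i (word u) (word v)))
                   (x≤y⊔x (lookup (word u) i) (lookup (word v) i)))
    , λ w (ext p) (ext q) → ext λ i →
        subst (Fin._≤ lookup (word w) i) (sym (lookup-⊔ i (word u) (word v))) (⊔-lub (p i) (q i))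

  ∧-infimum : Infimum _≤_ _∧_
  ∧-infimum u v =
      ext (λ i → Fin.≤-trans (reset-≤ m i)
            (subst (Fin._≤ lookup (word u) i) (sym (lookup-⊓ i (word u) (word v)))
              (x⊓y≤x (lookup (word u) i) (lookup (word v) i))))
    , ext (λ i → Fin.≤-trans (reset-≤ m i)
            (subst (Fin._≤ lookup (word v) i) (sym (lookup-⊓ i (word u) (word v)))
              (x⊓y≤y (lookup (word u) i) (lookup (word v) i))))
    , λ w (ext p) (ext q) → ext (greatest w λ i →
        subst (lookup (word w) i Fin.≤_) (sym (lookup-⊓ i (word u) (word v))) (⊓-glb (p i) (q i)))
    where
    m = word u ⊓ʷ word v

    ≤1⇒≡0 : ∀ {a : Fin 3} → a Fin.≤ Fin.suc (Fin.zero {1}) → a ≢ 1F → a ≡ 0F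
    ≤1⇒≡0 {0F} _ _   = refl
    ≤1⇒≡0 {1F} _ a≢1 = contradiction refl a≢1
    ≤1⇒≡0 {2F} (ℕ.s≤s ()) _

    greatest : ∀ w → (∀ i → lookup (word w) i Fin.≤ lookup m i) →
               ∀ i → lookup (word w) i Fin.≤ lookup (reset m) i
    greatest w w≤m i with resetView m i
    ... | kept _ e = subst (lookup (word w) i Fin.≤_) (sym e) (w≤m i)
    ... | cleared (mᵢ , j , j<i , mⱼ) e =
      Fin.≤-reflexive (trans (≤1⇒≡0 (subst (lookup (word w) i Fin.≤_) mᵢ (w≤m i))
        (IsTriword.T3 (isTriword w) j<i (≤0⇒≡0 (subst (lookup (word w) j Fin.≤_) mⱼ (w≤m j)))))
        (sym e))

  at : ∀ {u v : Triword n} → u ≡ v → ∀ i → lookup (word u) i ≡ lookup (word v) i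
  at refl i = refl

  ∨-sd : ∀ a b c → a ∨ b ≡ a ∨ c → a ∨ (b ∧ c) ≡ a ∨ b
  ∨-sd a b c h = antisym (ext λ i → Fin.≤-reflexive (eq i)) (ext λ i → Fin.≤-reflexive (sym (eq i)))
    where
    A = word a ; B = word b ; C = word c
    hᵢ : ∀ i → lookup A i ⊔ lookup B i ≡ lookup A i ⊔ lookup C i
    hᵢ i = trans (sym (lookup-⊔ i A B)) (trans (at h i) (lookup-⊔ i A C))

    eq′ : ∀ i → lookup A i ⊔ lookup (reset (B ⊓ʷ C)) i ≡ lookup A i ⊔ lookup B i
    eq′ i with resetView (B ⊓ʷ C) i
    ... | kept _ e = trans (cong (lookup A i ⊔_) (trans e (lookup-⊓ i B C)))
                       (⊔-⊓-letters (lookup A i) (lookup B i) (lookup C i) (hᵢ i))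
    ... | cleared (mᵢ , j , j<i , mⱼ) e
      with ⊔-⊓-ones (lookup A i) (lookup B i) (lookup C i) (trans (sym (lookup-⊓ i B C)) mᵢ) (hᵢ i)
    ...   | inj₂ e′ = trans (cong (lookup A i ⊔_) e) e′
    ...   | inj₁ (b₁ , c₁) = ⊥-elim
      ([ (λ s → IsTriword.T3 (isTriword b) j<i (trans (sym s) (trans (sym (lookup-⊓ j B C)) mⱼ)) b₁)
       , (λ s → IsTriword.T3 (isTriword c) j<i (trans (sym s) (trans (sym (lookup-⊓ j B C)) mⱼ)) c₁)
       ]′ (⊓-sel (lookup B j) (lookup C j)))

    eq : ∀ i → lookup (word (a ∨ (b ∧ c))) i ≡ lookup (word (a ∨ b)) i
    eq i = trans (lookup-⊔ i A (reset (B ⊓ʷ C))) (trans (eq′ i) (sym (lookup-⊔ i A B)))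

  ∧-sd : ∀ a b c → a ∧ b ≡ a ∧ c → a ∧ (b ∨ c) ≡ a ∧ b
  ∧-sd a b c h = antisym (ext le)
    (let a∧b≤a , a∧b≤b , _ = ∧-infimum a b
         _ , _ , greatest = ∧-infimum a (b ∨ c)
         b≤b∨c , _ = ∨-supremum b c
     in greatest (a ∧ b) a∧b≤a (≤-trans {a ∧ b} {b} {b ∨ c} a∧b≤b b≤b∨c))
    where
    p = word a ⊓ʷ word b
    q = word a ⊓ʷ word c
    r = word a ⊓ʷ (word b ⊔ʷ word c)

    rᵢ : ∀ i → lookup r i ≡ lookup p i ⊔ lookup q i
    rᵢ i = trans (lookup-⊓ i (word a) _)
      (trans (cong (lookup (word a) i ⊓_) (lookup-⊔ i (word b) (word c)))
      (trans (⊓-⊔-distrib (lookup (word a) i) (lookup (word b) i) (lookup (word c) i))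
        (sym (cong₂ _⊔_ (lookup-⊓ i (word a) (word b)) (lookup-⊓ i (word a) (word c))))))

    h′ : reset p ≡ reset q
    h′ = cong word h

    -- If r has an entry 1 where reset p has an entry 0 further left, then it is reset.
    clears : ∀ i j → j Fin.< i → lookup (reset p) j ≡ 0F → lookup r i ≡ 1F →
             lookup (reset r) i ≡ 0F
    clears i j j<i z rᵢ≡1 with resetView r i
    ... | cleared _ e = e
    ... | kept ¬r _ with k , k≤j , pₖ , qₖ ← common-zero p q h′ j (Fin.<-wellFounded j) z =
      contradiction (rᵢ≡1 , k , ℕ.≤-<-trans k≤j j<i , trans (rᵢ k) (cong₂ _⊔_ pₖ qₖ)) ¬r

    le : ∀ i → lookup (reset r) i Fin.≤ lookup (reset p) i
    le i with resetView p i | resetView q i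
    ... | kept _ eᵖ | kept _ eᑫ =
      subst (lookup (reset r) i Fin.≤_)
        (trans (rᵢ i) (trans (cong₂ _⊔_ (sym eᵖ) (trans (sym eᑫ) (sym (cong (λ w → lookup w i) h′))))
          ([ (λ e → e) , (λ e → e) ]′ (⊔-sel (lookup (reset p) i) (lookup (reset p) i)))))
        (reset-≤ r i)
    ... | cleared (pᵢ , j , j<i , pⱼ) e | cleared (qᵢ , _) _ =
      Fin.≤-reflexive (trans (clears i j j<i (reset-zero p j pⱼ)
        (trans (rᵢ i) (cong₂ _⊔_ pᵢ qᵢ))) (sym e))
    ... | cleared (pᵢ , j , j<i , pⱼ) e | kept _ eᑫ =
      Fin.≤-reflexive (trans (clears i j j<i (reset-zero p j pⱼ)
        (trans (rᵢ i) (cong₂ _⊔_ pᵢ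
          (trans (sym eᑫ) (trans (sym (cong (λ w → lookup w i) h′)) e))))) (sym e))
    ... | kept _ eᵖ | cleared (qᵢ , j , j<i , qⱼ) e =
      Fin.≤-reflexive (trans (clears i j j<i
        (trans (cong (λ w → lookup w j) h′) (reset-zero q j qⱼ))
        (trans (rᵢ i) (cong₂ _⊔_ (trans (sym eᵖ) pᵢ′) qᵢ))) (sym pᵢ′))
      where
      pᵢ′ : lookup (reset p) i ≡ 0F
      pᵢ′ = trans (cong (λ w → lookup w i) h′) e

  isLattice : IsLattice _≡_ _≤_ _∨_ _∧_
  isLattice = record
    { isPartialOrder = isPartialOrder
    ; supremum       = ∨-supremum
    ; infimum        = ∧-infimum
    }

Hoch : ℕ → FiniteSemidistributiveLattice
Hoch n = record
  { finitePoset        = Tri-poset n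
  ; _∨_                = _∨_
  ; _∧_                = _∧_
  ; isLattice          = isLattice
  ; ∨-semidistributive = ∨-sd
  ; ∧-semidistributive = ∧-sd
  }
  where open TriwordLattice

------------------------------------------------------------------------
-- The M-triangle

module _ where

  open CommutativeRing ℤ[x,y]-ring
  open import Algebra.Properties.Semiring.Exp semiring public using (_^_)

  con : ℤ → Carrier
  con c = ℤ[x,y].constant (ℤ[x].constant c)

  x y : Carrier
  x = ℤ[x,y].constant ℤ[x].X
  y = ℤ[x,y].X

  M-triangle : (P : FinitePoset) → (FinitePoset.Carrier P → ℕ) → Carrier
  M-triangle P rk = sum λ u → sum λ v → con (μ u v) * x ^ rk u * y ^ rk v
    where
    open FinitePoset P using (elements; μ)
    sum : (FinitePoset.Carrier P → Carrier) → Carrier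
    sum f = foldr _+_ 0# (List.map f elements)

{-# OPTIONS --safe #-}
module Submission where

-- For a triword u, the set Ψ(u) consists of the words a_i with a single 2, at i,
-- for every i with u_i = 2, and, if u contains a 1, of the words 1^i (i ones, then
-- zeros) for every i from the last 1 of u up to just before its first 0.  Hence
-- the core label order compares triwords position by position, by the two bits
-- that record whether a_i and whether 1^i is a label, and the rank of u is its
-- number of 2s, plus one if u contains a 1.
--
-- By Möbius inversion G(v) = ∑_u μ(u,v) x^rk(u) is the unique function with
-- ∑_{v ⊑ w} G(v) = x^rk(w) for all w.  With c = x - 1 and s the number of 2s in
-- v, the solution is G(v) = c^s if v contains no 1, and G(v) = c^s (c - b) if b
-- twos follow the last 1 of v immediately.  Both this and the evaluation of
-- ∑_v G(v) y^rk(v) are recursions along the letters.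

open import Algebra.Bundles using (CommutativeRing)
import Algebra.Construct.NaturalChoice.Max
import Algebra.Properties.AbelianGroup
import Algebra.Properties.Ring
import Algebra.Properties.Semiring.Exp
import Algebra.Solver.Ring as RingSolver
open import Algebra.Solver.Ring.AlmostCommutativeRing
  using (fromCommutativeRing; _-Raw-AlmostCommutative⟶_)
open import Data.Bool.Base using (Bool; true; false; if_then_else_; _∧_)
open import Data.Fin.Base as Fin using (Fin; toℕ)
import Data.Fin.Induction as Fin
open import Data.Fin.Patterns using (0F; 1F; 2F)
import Data.Fin.Properties as Fin
open import Data.Integer.Base as ℤ using (ℤ; 0ℤ; 1ℤ; +_)
import Data.Integer.Properties as ℤ
open import Data.List.Base as List using (List; []; _∷_; _++_; filter; foldr)
open import Data.List.Membership.Propositional using (_∈_)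
import Data.List.Membership.Propositional.Properties as ∈
open import Data.List.Membership.Propositional.Properties.WithK using (unique∧set⇒bag)
open import Data.List.Relation.Binary.BagAndSetEquality using (∼bag⇒↭)
open import Data.List.Relation.Binary.Permutation.Propositional as ↭ using (_↭_)
open import Data.List.Relation.Unary.All as All using (All; []; _∷_)
import Data.List.Relation.Unary.All.Properties as All
open import Data.List.Relation.Unary.AllPairs using ([]; _∷_)
open import Data.List.Relation.Unary.Any using (here; there)
open import Data.List.Relation.Unary.Unique.Propositional using (Unique)
import Data.List.Relation.Unary.Unique.Propositional.Properties as Unique
open import Data.Maybe.Base using (Maybe; just; nothing)
open import Data.Nat.Base as ℕ using (ℕ; zero; suc; _∸_)
import Data.Nat.Properties as ℕ
open import Data.Product.Base using (∃-syntax; _×_; _,_; proj₁; proj₂)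
open import Data.Sum.Base as Sum using (_⊎_; inj₁; inj₂; [_,_]′)
open import Data.Vec.Base as Vec using (Vec; []; _∷_; lookup; tabulate; _[_]≔_)
import Data.Vec.Properties as Vec
open import Data.Vec.Relation.Binary.Pointwise.Extensional using (ext; module Pointwise)
open import Function.Base using (_∘_; id; case_of_)
open import Function.Bundles using (mk⇔)
open import Induction.WellFounded using (Acc; acc)
open import Level using (Level)
open import Relation.Binary.Definitions using (tri<; tri≈; tri>)
open import Relation.Binary.PropositionalEquality as ≡ using (_≡_; _≢_; cong; subst)
import Relation.Binary.Reasoning.Setoid
open import Relation.Nullary.Decidable using (Dec; yes; no; does; _×-dec_; ¬?; decidable-stable)
open import Relation.Nullary.Negation using (¬_; contradiction)
open import Defs hiding (x; y; con; _^_)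
open Pointwise using (app)

-- Condition (T3) decides which 2s count twice. From the last 1 of `u` on, the nucleus is 0: it is 0
-- at that 1, hence never 1 to the right of it, and it keeps no 2 of `u`. So a 2 between the last 1
-- and the first 0 can pass through the value 1 on the way up from the nucleus, and contributes 1^i
-- as well as a_i. Before the last 1 the nucleus is nonzero, and after the first 0 the value 1 is
-- forbidden; there a 2 contributes a_i alone.
--
-- These doubled 2s are the obstacle to a product formula. Among words with the same last 1, below a
-- doubled 2 there is only another doubled 2 or a 0 that ends the run, after which all 2s are
-- single. The correction c - b counts them, and the inductions over a run close only if the number
-- κ of 2s already passed is a parameter. Every sum over a run is then affine in κ.
--
-- Triwords are replaced by codes in which the last 1 and the first 0 are constructors, so that
-- order, rank and sums recurse on the same data.

-- Finite sums in a commutative ring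

module ListSum {c ℓ : Level} (R : CommutativeRing c ℓ) where

  open CommutativeRing R
  open Relation.Binary.Reasoning.Setoid setoid

  private
    variable
      A B : Set

  sumOver : List A → (A → Carrier) → Carrier
  sumOver as f = foldr _+_ 0# (List.map f as)

  infix 8 _when_
  _when_ : Carrier → Bool → Carrier
  a when b = if b then a else 0#

  when-cong : ∀ b {r s} → r ≈ s → r when b ≈ s when b
  when-cong true  e = e
  when-cong false e = refl

  *-when : ∀ b r s → r * s when b ≈ (r * s) when b
  *-when true  r s = refl
  *-when false r s = zeroʳ r

  when-* : ∀ b r s → (r when b) * s ≈ (r * s) when b
  when-* true  r s = refl
  when-* false r s = zeroˡ s

  when-yes : ∀ {P : Set} (d : Dec P) {r} → P → r when does d ≈ r
  when-yes (yes _) p = refl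
  when-yes (no ¬p) p = contradiction p ¬p

  when-no : ∀ {P : Set} (d : Dec P) {r} → ¬ P → r when does d ≈ 0#
  when-no (yes p) ¬p = contradiction p ¬p
  when-no (no _)  ¬p = refl

  when-zero : ∀ {P : Set} (d : Dec P) {r} → (P → r ≈ 0#) → r when does d ≈ 0#
  when-zero (yes p) e = e p
  when-zero (no _)  e = refl

  interchange : ∀ a b c d → (a + b) + (c + d) ≈ (a + c) + (b + d)
  interchange a b c d = begin
    (a + b) + (c + d)  ≈⟨ +-assoc a b (c + d) ⟩
    a + (b + (c + d))  ≈⟨ +-congˡ (+-assoc b c d) ⟨
    a + ((b + c) + d)  ≈⟨ +-congˡ (+-congʳ (+-comm b c)) ⟩
    a + ((c + b) + d)  ≈⟨ +-congˡ (+-assoc c b d) ⟩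
    a + (c + (b + d))  ≈⟨ +-assoc a c (b + d) ⟨
    (a + c) + (b + d)  ∎

  sum-cong : ∀ (as : List A) {f g} → (∀ a → f a ≈ g a) → sumOver as f ≈ sumOver as g
  sum-cong []       e = refl
  sum-cong (a ∷ as) e = +-cong (e a) (sum-cong as e)

  sum-zero : ∀ (as : List A) {f} → (∀ {a} → a ∈ as → f a ≈ 0#) → sumOver as f ≈ 0#
  sum-zero []       e = refl
  sum-zero (a ∷ as) e = trans (+-cong (e (here ≡.refl)) (sum-zero as (e ∘ there))) (+-identityˡ 0#)

  sum-+ : ∀ (as : List A) f g → sumOver as (λ a → f a + g a) ≈ sumOver as f + sumOver as g
  sum-+ []       f g = sym (+-identityˡ 0#)
  sum-+ (a ∷ as) f g = trans (+-congˡ (sum-+ as f g)) (interchange (f a) (g a) _ _)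

  *-sum : ∀ r (as : List A) f → r * sumOver as f ≈ sumOver as (λ a → r * f a)
  *-sum r []       f = zeroʳ r
  *-sum r (a ∷ as) f = trans (distribˡ r _ _) (+-congˡ (*-sum r as f))

  sum-* : ∀ (as : List A) f r → sumOver as f * r ≈ sumOver as (λ a → f a * r)
  sum-* as f r = begin
    sumOver as f * r            ≈⟨ *-comm _ r ⟩
    r * sumOver as f            ≈⟨ *-sum r as f ⟩
    sumOver as (λ a → r * f a)  ≈⟨ sum-cong as (λ a → *-comm r (f a)) ⟩
    sumOver as (λ a → f a * r)  ∎

  sum-when : ∀ b (as : List A) f → sumOver as f when b ≈ sumOver as (λ a → f a when b)
  sum-when true  as f = refl
  sum-when false as f = sym (sum-zero as λ _ → refl)

  sum-swap : ∀ (as : List A) (bs : List B) (f : A → B → Carrier) →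
    sumOver as (λ a → sumOver bs (f a)) ≈ sumOver bs (λ b → sumOver as (λ a → f a b))
  sum-swap []       bs f = sym (sum-zero bs λ _ → refl)
  sum-swap (a ∷ as) bs f = trans (+-congˡ (sum-swap as bs f)) (sym (sum-+ bs (f a) _))

  sum-++ : ∀ (as bs : List A) f → sumOver (as ++ bs) f ≈ sumOver as f + sumOver bs f
  sum-++ []       bs f = sym (+-identityˡ _)
  sum-++ (a ∷ as) bs f = trans (+-congˡ (sum-++ as bs f)) (sym (+-assoc _ _ _))

  sum-map : ∀ (h : A → B) as f → sumOver (List.map h as) f ≈ sumOver as (f ∘ h)
  sum-map h []       f = refl
  sum-map h (a ∷ as) f = +-congˡ (sum-map h as f)

  sum-↭ : ∀ {as bs : List A} → as ↭ bs → ∀ f → sumOver as f ≈ sumOver bs f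
  sum-↭ ↭.refl        f = refl
  sum-↭ (↭.prep a p)  f = +-congˡ (sum-↭ p f)
  sum-↭ (↭.swap a b p) f = begin
    f a + (f b + _)  ≈⟨ +-assoc (f a) (f b) _ ⟨
    (f a + f b) + _  ≈⟨ +-cong (+-comm (f a) (f b)) (sum-↭ p f) ⟩
    (f b + f a) + _  ≈⟨ +-assoc (f b) (f a) _ ⟩
    f b + (f a + _)  ∎
  sum-↭ (↭.trans p q) f = trans (sum-↭ p f) (sum-↭ q f)

  -- Two duplicate-free lists that both contain every element of the type are permutations of each
  -- other.
  sum-unique : ∀ {as bs : List A} → Unique as → Unique bs →
    (∀ a → a ∈ as) → (∀ a → a ∈ bs) → ∀ f → sumOver as f ≈ sumOver bs f
  sum-unique ua ub as∋ bs∋ =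
    sum-↭ (∼bag⇒↭ (unique∧set⇒bag ua ub λ {a} → mk⇔ (λ _ → bs∋ a) (λ _ → as∋ a)))

  sum-single : ∀ {as : List A} {a f} → Unique as → a ∈ as → (∀ b → b ≢ a → f b ≈ 0#) →
    sumOver as f ≈ f a
  sum-single {as = a ∷ as} (a∉ ∷ u) (here ≡.refl) z =
    trans (+-congˡ (sum-zero as λ b∈ → z _ λ b≡a → All.lookup a∉ b∈ (≡.sym b≡a))) (+-identityʳ _)
  sum-single {as = b ∷ as} (b∉ ∷ u) (there a∈) z =
    trans (+-cong (z b (All.lookup b∉ a∈)) (sum-single u a∈ z)) (+-identityˡ _)

  sum-filter : ∀ {P : A → Set} (P? : ∀ a → Dec (P a)) as f →
    sumOver (filter P? as) f ≈ sumOver as (λ a → f a when does (P? a))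
  sum-filter P? []       f = refl
  sum-filter P? (a ∷ as) f with does (P? a)
  ... | true  = +-congˡ (sum-filter P? as f)
  ... | false = trans (sum-filter P? as f) (sym (+-identityˡ _))

-- Möbius inversion over a finite poset

module MöbiusInversion {c ℓ : Level} (R : CommutativeRing c ℓ)
  (φ : CommutativeRing.rawRing ℤ.+-*-commutativeRing -Raw-AlmostCommutative⟶ fromCommutativeRing R)
  (P : FinitePoset) where

  open CommutativeRing R renaming (Carrier to A)
  open Relation.Binary.Reasoning.Setoid setoid
  open Algebra.Properties.Ring ring using (-‿injective)
  open Algebra.Properties.AbelianGroup +-abelianGroup using (∙-cancelʳ)
  open ListSum R
  open FinitePoset P
  open _-Raw-AlmostCommutative⟶_ φ

  sumBelow : Carrier → (Carrier → A) → A
  sumBelow w g = sumOver elements λ v → g v when does (v ≤? w)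

  sum-hom : ∀ {B : Set} (as : List B) f → ⟦ foldr ℤ._+_ 0ℤ (List.map f as) ⟧ ≈ sumOver as (⟦_⟧ ∘ f)
  sum-hom []       f = 0-homo
  sum-hom (a ∷ as) f = trans (+-homo _ _) (+-congˡ (sum-hom as f))

  sum-δ : ∀ w (g : Carrier → A) → sumOver elements (λ v → g v when does (v ≟ w)) ≈ g w
  sum-δ w g = trans
    (sum-single unique (complete w) λ v v≢w → when-no (v ≟ w) v≢w)
    (when-yes (w ≟ w) ≡.refl)

  -- The recursion defining `μ` runs over its second argument, so for `u < w` this is its unfolding:
  -- the term at `v = w` cancels the sum over `u ≤ v < w`.
  sumBelow-μ : ∀ u w → sumBelow w (λ v → ⟦ μ u v ⟧) ≈ 1# when does (u ≟ w)
  sumBelow-μ u w = go (u ≟ w) (u ≤? w)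
    where
    μ-zero : ∀ {v} → ¬ u ≤ v → ⟦ μ u v ⟧ ≈ 0#
    μ-zero u≰v = trans (reflexive (≡.cong ⟦_⟧ (μ-≰ u≰v))) 0-homo

    between? : ∀ v → Dec (u ≤ v × v < w)
    between? v = u ≤? v ×-dec v <? w

    betweens = filter between? elements

    split : u ≤ w → u ≢ w → ∀ v → ⟦ μ u v ⟧ when does (v ≤? w)
                ≈ ⟦ μ u v ⟧ when does (v ≟ w) + ⟦ μ u v ⟧ when does (between? v)
    split u≤w u≢w v = cases (v ≟ w) (v ≤? w) (u ≤? v)
      where
      cases : Dec (v ≡ w) → Dec (v ≤ w) → Dec (u ≤ v) → ⟦ μ u v ⟧ when does (v ≤? w)
                ≈ ⟦ μ u v ⟧ when does (v ≟ w) + ⟦ μ u v ⟧ when does (between? v)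
      cases (yes v≡w) _ _ = begin
        _ ≈⟨ when-yes (v ≤? w) (≤-reflexive v≡w) ⟩
        _ ≈⟨ +-identityʳ _ ⟨
        _ ≈⟨ +-cong (when-yes (v ≟ w) v≡w) (when-no (between? v) λ (_ , _ , v≢w) → v≢w v≡w) ⟨
        _ ∎
      cases (no v≢w) (no v≰w) _ = begin
        _ ≈⟨ when-no (v ≤? w) v≰w ⟩
        _ ≈⟨ +-identityʳ _ ⟨
        _ ≈⟨ +-cong (when-no (v ≟ w) v≢w) (when-no (between? v) λ (_ , v≤w , _) → v≰w v≤w) ⟨
        _ ∎
      cases (no v≢w) (yes v≤w) (yes u≤v) = begin
        _ ≈⟨ when-yes (v ≤? w) v≤w ⟩
        _ ≈⟨ +-identityˡ _ ⟨
        _ ≈⟨ +-cong (when-no (v ≟ w) v≢w) (when-yes (between? v) (u≤v , v≤w , v≢w)) ⟨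
        _ ∎
      cases (no v≢w) (yes v≤w) (no u≰v) = begin
        _ ≈⟨ when-yes (v ≤? w) v≤w ⟩
        _ ≈⟨ μ-zero u≰v ⟩
        _ ≈⟨ +-identityʳ _ ⟨
        _ ≈⟨ +-cong (when-no (v ≟ w) v≢w) (when-no (between? v) λ (u≤v , _) → u≰v u≤v) ⟨
        _ ∎

    go : Dec (u ≡ w) → Dec (u ≤ w) → sumBelow w (λ v → ⟦ μ u v ⟧) ≈ 1# when does (u ≟ w)
    go (yes ≡.refl) _ = begin
      sumBelow u (λ v → ⟦ μ u v ⟧)  ≈⟨ sum-single unique (complete u) off ⟩
      _                             ≈⟨ when-yes (u ≤? u) ≤-refl ⟩
      ⟦ μ u u ⟧                     ≡⟨ ≡.cong ⟦_⟧ (μ-refl u) ⟩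
      ⟦ 1ℤ ⟧                        ≈⟨ 1-homo ⟩
      1#                            ≈⟨ when-yes (u ≟ u) ≡.refl ⟨
      1# when does (u ≟ u)          ∎
      where
      off : ∀ v → v ≢ u → ⟦ μ u v ⟧ when does (v ≤? u) ≈ 0#
      off v v≢u = when-zero (v ≤? u) λ v≤u → μ-zero λ u≤v → v≢u (antisym v≤u u≤v)
    go (no u≢w) (no u≰w) = trans
      (sum-zero elements λ {v} _ → when-zero (v ≤? w) λ v≤w → μ-zero λ u≤v → u≰w (≤-trans u≤v v≤w))
      (sym (when-no (u ≟ w) u≢w))
    go (no u≢w) (yes u≤w) = begin
      sumBelow w (λ v → ⟦ μ u v ⟧)
        ≈⟨ sum-cong elements (split u≤w u≢w) ⟩
      sumOver elements (λ v → ⟦ μ u v ⟧ when does (v ≟ w) + ⟦ μ u v ⟧ when does (between? v))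
        ≈⟨ sum-+ elements _ _ ⟩
      sumOver elements (λ v → ⟦ μ u v ⟧ when does (v ≟ w))
        + sumOver elements (λ v → ⟦ μ u v ⟧ when does (between? v))
        ≈⟨ +-cong (sum-δ w λ v → ⟦ μ u v ⟧) (sym (sum-filter between? elements _)) ⟩
      ⟦ μ u w ⟧ + sumOver betweens (λ v → ⟦ μ u v ⟧)
        ≈⟨ +-cong (trans (reflexive (≡.cong ⟦_⟧ (μ-< (u≤w , u≢w)))) (-‿homo _))
                  (sym (sum-hom betweens (μ u))) ⟩
      - ⟦ s ⟧ + ⟦ s ⟧
        ≈⟨ -‿inverseˡ _ ⟩
      0#
        ≈⟨ when-no (u ≟ w) u≢w ⟨
      1# when does (u ≟ w) ∎
      where
      s = foldr ℤ._+_ 0ℤ (List.map (μ u) betweens)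

  -- The system is triangular: by induction along `<` the sums strictly below `w` agree, and
  -- cancelling them leaves the values at `w`.
  sumBelow-injective : ∀ g g′ → (∀ w → sumBelow w g ≈ sumBelow w g′) → ∀ w → g w ≈ g′ w
  sumBelow-injective g g′ e w = go w (<-wellFounded w)
    where
    strictly : Carrier → (Carrier → A) → A
    strictly w g = sumOver elements λ v → g v when does (v <? w)
    split : ∀ w (g : Carrier → A) v → g v when does (v ≤? w) ≈ g v when does (v ≟ w) + g v when does (v <? w)
    split w g v = cases (v ≟ w) (v ≤? w)
      where
      cases : Dec (v ≡ w) → Dec (v ≤ w) →
              g v when does (v ≤? w) ≈ g v when does (v ≟ w) + g v when does (v <? w)
      cases (yes v≡w) _ = begin
        _ ≈⟨ when-yes (v ≤? w) (≤-reflexive v≡w) ⟩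
        _ ≈⟨ +-identityʳ _ ⟨
        _ ≈⟨ +-cong (when-yes (v ≟ w) v≡w) (when-no (v <? w) λ (_ , v≢w) → v≢w v≡w) ⟨
        _ ∎
      cases (no v≢w) (no v≰w) = begin
        _ ≈⟨ when-no (v ≤? w) v≰w ⟩
        _ ≈⟨ +-identityʳ _ ⟨
        _ ≈⟨ +-cong (when-no (v ≟ w) v≢w) (when-no (v <? w) λ (v≤w , _) → v≰w v≤w) ⟨
        _ ∎
      cases (no v≢w) (yes v≤w) = begin
        _ ≈⟨ when-yes (v ≤? w) v≤w ⟩
        _ ≈⟨ +-identityˡ _ ⟨
        _ ≈⟨ +-cong (when-no (v ≟ w) v≢w) (when-yes (v <? w) (v≤w , v≢w)) ⟨
        _ ∎
    unfold : ∀ w g → sumBelow w g ≈ g w + strictly w g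
    unfold w g = trans (sum-cong elements (split w g))
      (trans (sum-+ elements _ _) (+-congʳ (sum-δ w g)))
    go : ∀ w → Acc _<_ w → g w ≈ g′ w
    go w (acc rs) = ∙-cancelʳ (strictly w g) (g w) (g′ w) (begin
      g w + strictly w g    ≈⟨ unfold w g ⟨
      sumBelow w g          ≈⟨ e w ⟩
      sumBelow w g′         ≈⟨ unfold w g′ ⟩
      g′ w + strictly w g′  ≈⟨ +-congˡ (sum-cong elements below) ⟨
      g′ w + strictly w g   ∎)
      where
      below : ∀ v → g v when does (v <? w) ≈ g′ v when does (v <? w)
      below v = cases (v <? w)
        where
        cases : (d : Dec (v < w)) → g v when does d ≈ g′ v when does d
        cases (yes v<w) = go v (rs v<w)
        cases (no _)    = refl

  -- By uniqueness it is enough to sum the left side below `w`. After exchanging the sums, the inner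
  -- one is `sumBelow-μ`, which keeps only the term `u = w`.
  inversion : ∀ g h → (∀ w → sumBelow w g ≈ h w) →
    ∀ v → sumOver elements (λ u → ⟦ μ u v ⟧ * h u) ≈ g v
  inversion g h e = sumBelow-injective _ g λ w → begin
    sumBelow w (λ v → sumOver elements (λ u → ⟦ μ u v ⟧ * h u))
      ≈⟨ sum-cong elements (λ v → sum-when (does (v ≤? w)) elements _) ⟩
    sumOver elements (λ v → sumOver elements (λ u → (⟦ μ u v ⟧ * h u) when does (v ≤? w)))
      ≈⟨ sum-swap elements elements _ ⟩
    sumOver elements (λ u → sumOver elements (λ v → (⟦ μ u v ⟧ * h u) when does (v ≤? w)))
      ≈⟨ sum-cong elements (λ u → sum-cong elements λ v → sym (when-* (does (v ≤? w)) _ _)) ⟩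
    sumOver elements (λ u → sumOver elements (λ v → ⟦ μ u v ⟧ when does (v ≤? w) * h u))
      ≈⟨ sum-cong elements (λ u → sym (sum-* elements _ (h u))) ⟩
    sumOver elements (λ u → sumBelow w (λ v → ⟦ μ u v ⟧) * h u)
      ≈⟨ sum-cong elements (λ u → trans (*-congʳ (sumBelow-μ u w))
           (trans (when-* (does (u ≟ w)) 1# (h u)) (when-cong (does (u ≟ w)) (*-identityˡ (h u))))) ⟩
    sumOver elements (λ u → h u when does (u ≟ w))
      ≈⟨ sum-δ w h ⟩
    h w
      ≈⟨ e w ⟨
    sumBelow w g ∎

-- Codes of triwords and their label bits

-- Triwords of length suc m, read from the left.  A Block is what follows the last
-- 1: a run of 2s, then (after gap, the first 0) letters in {0,2} given by bits.
-- In a Marked tail the last 1 is still to come (mark), and the bit of keep tells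
-- a 2 from a 1.  The first letter is 0 for plain, a 1 that is not the last one
-- for later, and the last 1 for first.
data Block : ℕ → Set where
  end  : Block 0
  two  : ∀ {m} → Block m → Block (suc m)
  gap : ∀ {m} → Vec Bool m → Block (suc m)

data Marked : ℕ → Set where
  keep : ∀ {m} → Bool → Marked m → Marked (suc m)
  mark : ∀ {m} → Block m → Marked (suc m)

data Code (m : ℕ) : Set where
  plain : Vec Bool m → Code m
  later : Marked m → Code m
  first : Block m → Code m

-- The two bits at position i say whether a_i and 1^i are core labels.
Letter : Set
Letter = Bool × Bool

-- These letters stand to the right of a 0, where an entry 1 is impossible; a 2 has the label a_i
-- alone.
free : ∀ {m} → Vec Bool m → Vec Letter m
free []      = []
free (s ∷ p) = (s , false) ∷ free p

blockLetters : ∀ {m} → Block m → Vec Letter m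
blockLetters end     = []
blockLetters (two b) = (true , true) ∷ blockLetters b
blockLetters (gap p) = (false , false) ∷ free p

-- Before the last 1 the nucleus is nonzero, so no 1^i is a label there.
markedLetters : ∀ {m} → Marked m → Vec Letter m
markedLetters (keep s w) = (s , false) ∷ markedLetters w
markedLetters (mark b)   = (false , true) ∷ blockLetters b

letters : ∀ {m} → Code m → Vec Letter (suc m)
letters (plain p) = (false , false) ∷ free p
letters (later w) = (false , false) ∷ markedLetters w
letters (first b) = (false , true) ∷ blockLetters b

infix 4 _≼_
infixr 5 _⇒_

_⇒_ : Bool → Bool → Bool
false ⇒ b = true
true  ⇒ b = b

_≼_ : ∀ {m} → Vec Letter m → Vec Letter m → Bool
[]            ≼ []              = true
(s , t) ∷ p ≼ (s′ , t′) ∷ p′ = (s ⇒ s′) ∧ ((t ⇒ t′) ∧ (p ≼ p′))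

size : ∀ {m} → Vec Letter m → ℕ
size []                = 0
size ((false , _) ∷ p) = size p
size ((true  , _) ∷ p) = suc (size p)

codeRank : ∀ {m} → Code m → ℕ
codeRank u@(plain _) = size (letters u)
codeRank u@(later _) = suc (size (letters u))
codeRank u@(first _) = suc (size (letters u))

frees : ∀ m → List (Vec Bool m)
frees zero    = [] ∷ []
frees (suc m) = List.map (false ∷_) (frees m) ++ List.map (true ∷_) (frees m)

blocks : ∀ m → List (Block m)
blocks zero    = end ∷ []
blocks (suc m) = List.map two (blocks m) ++ List.map gap (frees m)

markeds : ∀ m → List (Marked m)
markeds zero    = []
markeds (suc m) = List.map (keep false) (markeds m) ++
                  (List.map (keep true) (markeds m) ++ List.map mark (blocks m))

codes : ∀ m → List (Code m)
codes m = List.map plain (frees m) ++ (List.map later (markeds m) ++ List.map first (blocks m))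

-- The letter at `mark` has its second bit set, and no letter of `free p` has.
marked⋠free : ∀ {m} (w : Marked m) p → (markedLetters w ≼ free p) ≡ false
marked⋠free (mark b)         (_ ∷ p)     = ≡.refl
marked⋠free (keep false w)   (_ ∷ p)     = marked⋠free w p
marked⋠free (keep true  w)   (false ∷ p) = ≡.refl
marked⋠free (keep true  w)   (true  ∷ p) = marked⋠free w p

-- The solution of the inversion problem

module CodeSums {c ℓ : Level} (R : CommutativeRing c ℓ)
  (φ : CommutativeRing.rawRing ℤ.+-*-commutativeRing -Raw-AlmostCommutative⟶ fromCommutativeRing R)
  (x y : CommutativeRing.Carrier R) where

  open CommutativeRing R renaming (Carrier to A)
  open Relation.Binary.Reasoning.Setoid setoid
  open Algebra.Properties.Semiring.Exp semiring using (_^_)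
  open Algebra.Properties.Ring ring using (-0#≈0#)
  open ListSum R
  open _-Raw-AlmostCommutative⟶_ φ

  private
    _coeff≟_ : ∀ a b → Maybe (⟦ a ⟧ ≈ ⟦ b ⟧)
    a coeff≟ b with a ℤ.≟ b
    ... | yes e = just (reflexive (≡.cong ⟦_⟧ e))
    ... | no _  = nothing

  open RingSolver (CommutativeRing.rawRing ℤ.+-*-commutativeRing) (fromCommutativeRing R) φ _coeff≟_
    using (Polynomial; solve; _:=_; _:+_; _:*_; _:-_; _:^_)
    renaming (con to :con)

  -- :con 1ℤ would denote ⟦ 1ℤ ⟧, which is not definitionally 1#.
  :1 : ∀ {n} → Polynomial n
  :1 = :con 0ℤ :^ 0

  c₁ : A
  c₁ = x - 1#

  -- κ is the number of 2s already passed in the run after the last 1.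
  gFree : ∀ {m} → Vec Bool m → A
  gFree p = c₁ ^ size (free p)

  gBlock : ∀ {m} → A → Block m → A
  gBlock κ end     = c₁ - κ
  gBlock κ (two b) = c₁ * gBlock (κ + 1#) b
  gBlock κ (gap p) = (c₁ - κ) * gFree p

  gMarked : ∀ {m} → Marked m → A
  gMarked (keep false w) = gMarked w
  gMarked (keep true  w) = c₁ * gMarked w
  gMarked (mark b)       = gBlock 0# b

  g : ∀ {m} → Code m → A
  g (plain p) = gFree p
  g (later w) = gMarked w
  g (first b) = gBlock 0# b

  -- c^(b+1) x^r, where b is the length of the initial run of 2s and r is the
  -- number of 2s after it.
  residue : ∀ {m} → Block m → A
  residue end     = c₁
  residue (two b) = c₁ * residue b
  residue (gap p) = c₁ * x ^ size (free p)

  sum-map-++ : ∀ {B C : Set} (h : B → C) as bs f →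
    sumOver (List.map h as ++ bs) f ≈ sumOver as (f ∘ h) + sumOver bs f
  sum-map-++ h as bs f = trans (sum-++ (List.map h as) bs f) (+-congʳ (sum-map h as f))

  *-sum-when : ∀ {B : Set} r (as : List B) (b : B → Bool) (f : B → A) →
    sumOver as (λ a → (r * f a) when b a) ≈ r * sumOver as (λ a → f a when b a)
  *-sum-when r as b f = trans (sum-cong as λ a → sym (*-when (b a) r (f a))) (sym (*-sum r as _))

  -- A 0 contributes 1 and a 2 contributes `x - 1`, so each position where `v` allows a 2
  -- contributes the factor `x`. The word `v` is arbitrary because free words are also summed below
  -- runs and below marked tails.
  sum-frees : ∀ {m} (v : Vec Letter m) →
    sumOver (frees m) (λ p → gFree p when (free p ≼ v)) ≈ x ^ size v
  sum-frees []      = +-identityʳ 1#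
  sum-frees {suc m} ((false , _) ∷ v) = begin
    _ ≈⟨ sum-map-++ (false ∷_) (frees m) _ _ ⟩
    _ ≈⟨ +-cong (sum-frees v) (trans (sum-map (true ∷_) (frees m) _) (sum-zero (frees m) λ _ → refl)) ⟩
    _ ≈⟨ +-identityʳ _ ⟩
    _ ∎
  sum-frees {suc m} ((true , _) ∷ v) = begin
    _ ≈⟨ sum-map-++ (false ∷_) (frees m) _ _ ⟩
    _ ≈⟨ +-cong (sum-frees v) (trans (sum-map (true ∷_) (frees m) _)
           (trans (*-sum-when c₁ (frees m) _ gFree) (*-congˡ (sum-frees v)))) ⟩
    x ^ size v + c₁ * x ^ size v
      ≈⟨ solve 2 (λ x X → X :+ (x :- :1) :* X := x :* X) refl x (x ^ size v) ⟩
    _ ∎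

  -- A 2 shifts κ by one, so κ has to vary in the induction. In that step the extra `- c₁ * X` due
  -- to the shift cancels the `c₁ * X` from the words whose run stops here, where `X` is the power
  -- of `x` of the tail; what remains of the κ-terms combines to `- κ * (x * X)` because
  -- `x = c₁ + 1`.
  sum-blocks : ∀ {m} (v : Block m) κ →
    sumOver (blocks m) (λ u → gBlock κ u when (blockLetters u ≼ blockLetters v))
      ≈ residue v - κ * x ^ size (blockLetters v)
  sum-blocks end κ = trans (+-identityʳ _) (+-congˡ (-‿cong (sym (*-identityʳ κ))))
  sum-blocks {suc m} (two v) κ = begin
    _ ≈⟨ sum-map-++ two (blocks m) _ _ ⟩
    _ ≈⟨ +-cong
           (trans (*-sum-when c₁ (blocks m) _ (gBlock (κ + 1#))) (*-congˡ (sum-blocks v (κ + 1#))))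
           (trans (sum-map gap (frees m) _)
             (trans (*-sum-when (c₁ - κ) (frees m) _ gFree) (*-congˡ (sum-frees (blockLetters v))))) ⟩
    _ ≈⟨ solve 4 (λ x κ e X → (x :- :1) :* (e :- (κ :+ :1) :* X) :+ ((x :- :1) :- κ) :* X
                            := (x :- :1) :* e :- κ :* (x :* X))
           refl x κ (residue v) (x ^ size (blockLetters v)) ⟩
    _ ∎
  sum-blocks {suc m} (gap p) κ = begin
    _ ≈⟨ sum-map-++ two (blocks m) _ _ ⟩
    _ ≈⟨ +-cong
           (sum-zero (blocks m) λ _ → refl)
           (trans (sum-map gap (frees m) _)
             (trans (*-sum-when (c₁ - κ) (frees m) _ gFree) (*-congˡ (sum-frees (free p))))) ⟩
    _ ≈⟨ +-identityˡ _ ⟩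
    _ ≈⟨ solve 3 (λ c κ X → (c :- κ) :* X := c :* X :- κ :* X) refl c₁ κ (x ^ size (free p)) ⟩
    _ ∎

  sum-blocks₀ : ∀ {m} (v : Block m) →
    sumOver (blocks m) (λ u → gBlock 0# u when (blockLetters u ≼ blockLetters v)) ≈ residue v
  sum-blocks₀ v = begin
    _ ≈⟨ sum-blocks v 0# ⟩
    _ ≈⟨ +-congˡ (trans (-‿cong (zeroˡ _)) -0#≈0#) ⟩
    _ ≈⟨ +-identityʳ _ ⟩
    _ ∎

  sum-markeds-free : ∀ {m} p →
    sumOver (markeds m) (λ u → gMarked u when (markedLetters u ≼ free p)) ≈ 0#
  sum-markeds-free {m} p = sum-zero (markeds m) λ {u} _ →
    reflexive (≡.cong (gMarked u when_) (marked⋠free u p))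

  sum-markeds-suc : ∀ m f → sumOver (markeds (suc m)) f ≈
    sumOver (markeds m) (f ∘ keep false)
      + (sumOver (markeds m) (f ∘ keep true) + sumOver (blocks m) (f ∘ mark))
  sum-markeds-suc m f = trans (sum-map-++ (keep false) (markeds m) _ f)
    (+-congˡ (trans (sum-map-++ (keep true) (markeds m) _ f)
      (+-congˡ (sum-map mark (blocks m) f))))

  -- Of the amount `x * X - X` due to all words with a 1, with `X` the power of `x`, the words whose
  -- last 1 stands directly in front of the tail account for `residue v`; those whose last 1 is
  -- inside the tail supply the rest.
  sum-markeds-block : ∀ {m} (v : Block m) →
    sumOver (markeds m) (λ u → gMarked u when (markedLetters u ≼ blockLetters v))
      ≈ x * x ^ size (blockLetters v) - residue v - x ^ size (blockLetters v)
  sum-markeds-block end =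
    sym (trans (solve 1 (λ x → x :* :1 :- (x :- :1) :- :1 := :1 :- :1) refl x) (-‿inverseʳ 1#))
  sum-markeds-block {suc m} (two v) = begin
    _ ≈⟨ sum-markeds-suc m _ ⟩
    _ ≈⟨ +-cong (sum-markeds-block v) (+-cong
           (trans (*-sum-when c₁ (markeds m) _ gMarked) (*-congˡ (sum-markeds-block v)))
           (sum-blocks₀ v)) ⟩
    _ ≈⟨ solve 3 (λ x e X → (x :* X :- e :- X) :+ ((x :- :1) :* (x :* X :- e :- X) :+ e)
                          := x :* (x :* X) :- (x :- :1) :* e :- x :* X)
           refl x (residue v) (x ^ size (blockLetters v)) ⟩
    _ ∎
  sum-markeds-block {suc m} (gap p) = begin
    _ ≈⟨ sum-markeds-suc m _ ⟩
    -- A first letter with both bits clear excludes `keep true` and `mark`, and `keep false` leaves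
    -- a marked tail below a free one, so all three sums vanish.
    _ ≈⟨ +-cong (sum-markeds-free p) (+-cong
           (sum-zero (markeds m) λ _ → refl) (sum-zero (blocks m) λ _ → refl)) ⟩
    _ ≈⟨ trans (+-identityˡ _) (+-identityˡ _) ⟩
    0# ≈⟨ -‿inverseʳ X ⟨
    _ ≈⟨ solve 2 (λ x X → X :- X := x :* X :- (x :- :1) :* X :- X) refl x X ⟩
    _ ∎
    where X = x ^ size (free p)

  sum-markeds : ∀ {m} (v : Marked m) →
    sumOver (markeds m) (λ u → gMarked u when (markedLetters u ≼ markedLetters v))
      ≈ x * x ^ size (markedLetters v) - x ^ size (markedLetters v)
  sum-markeds {suc m} (keep false v) = begin
    _ ≈⟨ sum-markeds-suc m _ ⟩
    _ ≈⟨ +-cong (sum-markeds v) (+-cong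
           (sum-zero (markeds m) λ _ → refl) (sum-zero (blocks m) λ _ → refl)) ⟩
    _ ≈⟨ trans (+-congˡ (+-identityˡ _)) (+-identityʳ _) ⟩
    _ ∎
  sum-markeds {suc m} (keep true v) = begin
    _ ≈⟨ sum-markeds-suc m _ ⟩
    _ ≈⟨ +-cong (sum-markeds v) (+-cong
           (trans (*-sum-when c₁ (markeds m) _ gMarked) (*-congˡ (sum-markeds v)))
           (sum-zero (blocks m) λ _ → refl)) ⟩
    _ ≈⟨ +-congˡ (+-identityʳ _) ⟩
    _ ≈⟨ solve 2 (λ x X → (x :* X :- X) :+ (x :- :1) :* (x :* X :- X) := x :* (x :* X) :- x :* X)
           refl x (x ^ size (markedLetters v)) ⟩
    _ ∎
  sum-markeds {suc m} (mark v) = begin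
    _ ≈⟨ sum-markeds-suc m _ ⟩
    _ ≈⟨ +-cong (sum-markeds-block v) (+-cong
           (sum-zero (markeds m) λ _ → refl) (sum-blocks₀ v)) ⟩
    _ ≈⟨ +-congˡ (+-identityˡ _) ⟩
    _ ≈⟨ solve 3 (λ x e X → (x :* X :- e :- X) :+ e := x :* X :- X)
           refl x (residue v) (x ^ size (blockLetters v)) ⟩
    _ ∎

  sum-codes-split : ∀ m f → sumOver (codes m) f ≈
    sumOver (frees m) (f ∘ plain)
      + (sumOver (markeds m) (f ∘ later) + sumOver (blocks m) (f ∘ first))
  sum-codes-split m f = trans (sum-map-++ plain (frees m) _ f)
    (+-congˡ (trans (sum-map-++ later (markeds m) _ f)
      (+-congˡ (sum-map first (blocks m) f))))

  sum-codes : ∀ {m} (v : Code m) →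
    sumOver (codes m) (λ u → g u when (letters u ≼ letters v)) ≈ x ^ codeRank v
  sum-codes {m} (plain p) = begin
    _ ≈⟨ sum-codes-split m _ ⟩
    _ ≈⟨ +-cong (sum-frees (free p)) (+-cong (sum-markeds-free p) (sum-zero (blocks m) λ _ → refl)) ⟩
    _ ≈⟨ trans (+-congˡ (+-identityˡ _)) (+-identityʳ _) ⟩
    _ ∎
  sum-codes {m} (later v) = begin
    _ ≈⟨ sum-codes-split m _ ⟩
    _ ≈⟨ +-cong (sum-frees (markedLetters v)) (+-cong (sum-markeds v) (sum-zero (blocks m) λ _ → refl)) ⟩
    _ ≈⟨ +-congˡ (+-identityʳ _) ⟩
    _ ≈⟨ solve 2 (λ x X → X :+ (x :* X :- X) := x :* X) refl x (x ^ size (markedLetters v)) ⟩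
    _ ∎
  sum-codes {m} (first v) = begin
    _ ≈⟨ sum-codes-split m _ ⟩
    _ ≈⟨ +-cong (sum-frees (blockLetters v)) (+-cong (sum-markeds-block v) (sum-blocks₀ v)) ⟩
    _ ≈⟨ solve 3 (λ x e X → X :+ ((x :* X :- e :- X) :+ e) := x :* X)
           refl x (residue v) (x ^ size (blockLetters v)) ⟩
    _ ∎

  -- The generating function of the solution

  -- `t` is the weight `c₁ * y` of a 2, and `q = 1 + t` is the total weight of a free letter, which
  -- is 0 or 2. This is the base of the power in the final formula.
  q t : A
  q = x * y - y + 1#
  t = (x - 1#) * y

  -- The recursion peels off the first letter at κ = 0: a 2 raises κ to 1, which costs `q ^ m`, and
  -- a gap leaves free letters, which total `q ^ m`.
  blockTotal : ℕ → A
  blockTotal zero    = c₁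
  blockTotal (suc m) = t * (blockTotal m - q ^ m) + c₁ * q ^ m

  markedTotal : ℕ → A
  markedTotal zero    = 0#
  markedTotal (suc m) = markedTotal m + (t * markedTotal m + y * blockTotal m)

  regroup : ∀ a b c d → (a * b) * (c * d) ≈ (a * c) * (b * d)
  regroup = solve 4 (λ a b c d → (a :* b) :* (c :* d) := (a :* c) :* (b :* d)) refl

  total-frees : ∀ m → sumOver (frees m) (λ p → gFree p * y ^ size (free p)) ≈ q ^ m
  total-frees zero    = trans (+-identityʳ _) (*-identityˡ 1#)
  total-frees (suc m) = begin
    _ ≈⟨ sum-map-++ (false ∷_) (frees m) _ _ ⟩
    _ ≈⟨ +-cong (total-frees m) (trans (sum-map (true ∷_) (frees m) _)
           (trans (sum-cong (frees m) λ p → regroup c₁ _ y _)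
             (trans (sym (*-sum t (frees m) _)) (*-congˡ (total-frees m))))) ⟩
    _ ≈⟨ solve 3 (λ x y Q → Q :+ ((x :- :1) :* y) :* Q := (x :* y :- y :+ :1) :* Q) refl x y (q ^ m) ⟩
    _ ∎

  -- As in `sum-blocks`, κ enters affinely; its coefficient `q ^ m` reproduces itself in the next
  -- length because `q = t + 1`.
  total-blocks : ∀ m κ → sumOver (blocks m) (λ b → gBlock κ b * y ^ size (blockLetters b))
    ≈ blockTotal m - κ * q ^ m
  total-blocks zero κ =
    trans (+-identityʳ _) (trans (*-identityʳ _) (+-congˡ (-‿cong (sym (*-identityʳ κ)))))
  total-blocks (suc m) κ = begin
    _ ≈⟨ sum-map-++ two (blocks m) _ _ ⟩
    _ ≈⟨ +-cong
           (trans (sum-cong (blocks m) λ b → regroup c₁ _ y _)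
             (trans (sym (*-sum t (blocks m) _)) (*-congˡ (total-blocks m (κ + 1#)))))
           (trans (sum-map gap (frees m) _)
             (trans (sum-cong (frees m) λ p → *-assoc (c₁ - κ) _ _)
               (trans (sym (*-sum (c₁ - κ) (frees m) _)) (*-congˡ (total-frees m))))) ⟩
    _ ≈⟨ solve 5 (λ x y κ K Q →
           ((x :- :1) :* y) :* (K :- (κ :+ :1) :* Q) :+ ((x :- :1) :- κ) :* Q
           := (((x :- :1) :* y) :* (K :- Q) :+ (x :- :1) :* Q) :- κ :* ((x :* y :- y :+ :1) :* Q))
           refl x y κ (blockTotal m) (q ^ m) ⟩
    _ ∎

  total-blocks₀ : ∀ m → sumOver (blocks m) (λ b → gBlock 0# b * y ^ suc (size (blockLetters b)))
    ≈ y * blockTotal m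
  total-blocks₀ m = begin
    _ ≈⟨ sum-cong (blocks m) (λ b → solve 3 (λ a y Y → a :* (y :* Y) := y :* (a :* Y)) refl
           (gBlock 0# b) y (y ^ size (blockLetters b))) ⟩
    _ ≈⟨ *-sum y (blocks m) _ ⟨
    _ ≈⟨ *-congˡ (trans (total-blocks m 0#)
           (trans (+-congˡ (trans (-‿cong (zeroˡ _)) -0#≈0#)) (+-identityʳ _))) ⟩
    _ ∎

  total-markeds : ∀ m → sumOver (markeds m) (λ w → gMarked w * y ^ suc (size (markedLetters w)))
    ≈ markedTotal m
  total-markeds zero    = refl
  total-markeds (suc m) = begin
    _ ≈⟨ sum-markeds-suc m _ ⟩
    _ ≈⟨ +-cong (total-markeds m) (+-cong
           (trans (sum-cong (markeds m) λ w → regroup c₁ _ y _)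
             (trans (sym (*-sum t (markeds m) _)) (*-congˡ (total-markeds m))))
           (total-blocks₀ m)) ⟩
    _ ∎

  total : ℕ → A
  total m = q ^ m + (markedTotal m + y * blockTotal m)

  total-codes : ∀ m → sumOver (codes m) (λ u → g u * y ^ codeRank u) ≈ total m
  total-codes m = begin
    _ ≈⟨ sum-codes-split m _ ⟩
    _ ≈⟨ +-cong (total-frees m) (+-cong (total-markeds m) (total-blocks₀ m)) ⟩
    _ ∎

  total-zero : total 0 ≈ q
  total-zero = trans (+-congˡ (+-identityˡ _))
    (solve 2 (λ x y → :1 :+ y :* (x :- :1) := x :* y :- y :+ :1) refl x y)

  -- All parts of `total m` reproduce themselves with the factor `q`. The remainder comes from
  -- `y * blockTotal (suc m)`: a gap right after the first letter gives `t * q ^ m`, and the shift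
  -- of κ by a 2 gives `- y * t * q ^ m`.
  total-suc : ∀ m → total (suc m) ≈ q * total m + t * (1# - y) * q ^ m
  total-suc m = solve 5 (λ x y Q M K →
    let t′ = (x :- :1) :* y ; q′ = x :* y :- y :+ :1 in
    q′ :* Q :+ ((M :+ (t′ :* M :+ y :* K)) :+ y :* (t′ :* (K :- Q) :+ (x :- :1) :* Q))
      := q′ :* (Q :+ (M :+ y :* K)) :+ t′ :* (:1 :- y) :* Q)
    refl x y (q ^ m) (markedTotal m) (blockTotal m)

  -- The inhomogeneous term of `total-suc` is itself a multiple of `q ^ m`, so each step adds one
  -- more copy of it; hence a factor linear in the length.
  total-closed : ∀ m → total (suc m) ≈ q ^ m * (q * q + ⟦ + suc m ⟧ * (t * (1# - y)))
  total-closed zero = begin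
    _ ≈⟨ total-suc 0 ⟩
    _ ≈⟨ +-congʳ (*-congˡ total-zero) ⟩
    _ ≈⟨ solve 2 (λ q s → q :* q :+ s :* :1 := :1 :* (q :* q :+ :con 1ℤ :* s)) refl q (t * (1# - y)) ⟩
    _ ∎
  total-closed (suc m) = begin
    _ ≈⟨ total-suc (suc m) ⟩
    _ ≈⟨ +-congʳ (*-congˡ (total-closed m)) ⟩
    _ ≈⟨ solve 4 (λ q s n Q → q :* (Q :* (q :* q :+ n :* s)) :+ s :* (q :* Q)
                            := (q :* Q) :* (q :* q :+ (:con 1ℤ :+ n) :* s))
           refl q (t * (1# - y)) ⟦ + suc m ⟧ (q ^ m) ⟩
    _ ≈⟨ *-congˡ (+-congˡ (*-congʳ (+-homo 1ℤ (+ suc m)))) ⟨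
    _ ∎

  closedForm : ∀ n → A
  closedForm n = ⟦ + (n ℕ.+ 1) ⟧ * ((x - 1#) * y - x * y ^ 2) + (⟦ + n ⟧ + x ^ 2) * y ^ 2 + 1#

  -- Here the word length is `n = suc m`, so the exponents are `2 ∸ n` and `n ∸ 2`. The power on the
  -- left differs from 1 only for `n = 1`, where the total is `q` and the closed form is its square.
  total-formula : ∀ m → q ^ (1 ∸ m) * total m ≈ q ^ (m ∸ 1) * closedForm (suc m)
  total-formula zero = begin
    _ ≈⟨ *-congˡ total-zero ⟩
    _ ≈⟨ solve 2 (λ x y → let q′ = x :* y :- y :+ :1 in q′ :* :1 :* q′ :=
           :1 :* (:con (+ 2) :* ((x :- :1) :* y :- x :* y :^ 2) :+ (:con 1ℤ :+ x :^ 2) :* y :^ 2 :+ :1))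
           refl x y ⟩
    _ ∎
  total-formula (suc m) = begin
    q ^ (0 ∸ m) * total (suc m)
      ≈⟨ *-congʳ (reflexive (≡.cong (q ^_) (ℕ.0∸n≡0 m))) ⟩
    1# * total (suc m)
      ≈⟨ *-identityˡ _ ⟩
    total (suc m)
      ≈⟨ total-closed m ⟩
    q ^ m * (q * q + ⟦ + suc m ⟧ * (t * (1# - y)))
      -- The length is now `suc (suc m)`; in terms of `n = suc m` its two coefficients are `2 + n`
      -- and `1 + n`.
      ≈⟨ *-congˡ (solve 3 (λ x y n →
           let t′ = (x :- :1) :* y ; q′ = x :* y :- y :+ :1 in
           q′ :* q′ :+ n :* (t′ :* (:1 :- y))
             := (:con (+ 2) :+ n) :* ((x :- :1) :* y :- x :* y :^ 2)
                :+ ((:con 1ℤ :+ n) :+ x :^ 2) :* y :^ 2 :+ :1)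
           refl x y ⟦ + suc m ⟧) ⟩
    _ ≈⟨ *-congˡ (+-congʳ (+-cong
           (*-congʳ (trans (sym (+-homo (+ 2) (+ suc m))) (reflexive (≡.cong (λ k → ⟦ + suc k ⟧) (ℕ.+-comm 1 (suc m))))))
           (*-congʳ (+-congʳ (sym (+-homo 1ℤ (+ suc m))))))) ⟩
    q ^ m * closedForm (suc (suc m)) ∎

open import Defs using (x; y; con; _^_)

constants : CommutativeRing.rawRing ℤ.+-*-commutativeRing
              -Raw-AlmostCommutative⟶ fromCommutativeRing ℤ[x,y]-ring
constants = record
  { ⟦_⟧    = con
  ; +-homo = λ _ _ → refl
  ; *-homo = λ a b → ℤ[x,y].mk λ
      { zero    → ℤ[x].mk λ { zero → ≡.sym (ℤ.+-identityʳ (a ℤ.* b)) ; (suc _) → ≡.refl }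
      ; (suc _) → ℤ[x].mk λ _ → ≡.refl
      }
  ; -‿homo = λ _ → refl
  -- `con 0ℤ` carries an explicit zero coefficient, whereas the zero of the ring is the empty list;
  -- they agree only coefficientwise.
  ; 0-homo = ℤ[x,y].mk λ
      { zero    → ℤ[x].mk λ { zero → ≡.refl ; (suc _) → ≡.refl }
      ; (suc _) → ℤ[x].mk λ _ → ≡.refl
      }
  ; 1-homo = refl
  }
  where open CommutativeRing ℤ[x,y]-ring

-- Ranked posets enumerated by codes

-- The order on codes is Boolean-valued, so that restricted sums over codes reduce along the
-- letters.
record Encoding (P : FinitePoset) (C : Set) : Set where
  open FinitePoset P
  field
    toElement            : C → Carrier
    toElement-surjective : ∀ a → ∃[ u ] toElement u ≡ a
    toElement-injective  : ∀ u v → toElement u ≡ toElement v → u ≡ v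
    leq               : C → C → Bool
    does-≤?           : ∀ u v → does (toElement u ≤? toElement v) ≡ leq u v
    rank              : C → ℕ
    rank-strict       : ∀ u v → leq u v ≡ true → u ≡ v ⊎ rank u ℕ.< rank v
    lower             : ∀ u → ((∀ v → leq u v ≡ true) × rank u ≡ 0) ⊎
                              ∃[ u′ ] (leq u′ u ≡ true × rank u ≡ suc (rank u′))
    allCodes             : List C
    allCodes-unique      : Unique allCodes
    allCodes-complete    : ∀ u → u ∈ allCodes

  encode : Carrier → C
  encode a = proj₁ (toElement-surjective a)

  toElement-encode : ∀ a → toElement (encode a) ≡ a
  toElement-encode a = proj₂ (toElement-surjective a)

  encode-toElement : ∀ u → encode (toElement u) ≡ u
  encode-toElement u = toElement-injective (encode (toElement u)) u (toElement-encode (toElement u))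

  leq⇒≤ : ∀ u v → leq u v ≡ true → toElement u ≤ toElement v
  leq⇒≤ u v e = go (toElement u ≤? toElement v) (≡.trans (does-≤? u v) e)
    where
    go : ∀ {A : Set} (d : Dec A) → does d ≡ true → A
    go (yes a) _ = a

  ≤⇒leq : ∀ u v → toElement u ≤ toElement v → leq u v ≡ true
  ≤⇒leq u v le = ≡.trans (≡.sym (does-≤? u v)) (go (toElement u ≤? toElement v))
    where
    go : (d : Dec (toElement u ≤ toElement v)) → does d ≡ true
    go (yes _) = ≡.refl
    go (no ≰)  = contradiction le ≰

module RankedEncoding {P : FinitePoset} {C : Set} (E : Encoding P C)
  {rk : FinitePoset.Carrier P → ℕ} (isRank : IsRankFunction P rk) where

  open FinitePoset P
  open Encoding E
  open IsRankFunction isRank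

  -- Induction on the rank: `lower` supplies an element one rank below, and nothing fits in between
  -- because ranks increase strictly, so the pair is a cover. This determines every rank function
  -- from its axioms.
  rank-toElement : ∀ k u → rank u ≡ k → rk (toElement u) ≡ k
  rank-toElement k u e with lower u
  ... | inj₁ (bottom , rank≡0) = ≡.trans
    (least (toElement u) λ a → subst (toElement u ≤_) (toElement-encode a) (leq⇒≤ u (encode a) (bottom (encode a))))
    (≡.trans (≡.sym rank≡0) e)
  rank-toElement zero    u e | inj₂ (u′ , le , eq) = contradiction (≡.trans (≡.sym eq) e) ℕ.1+n≢0
  rank-toElement (suc k) u e | inj₂ (u′ , le , eq) =
    ≡.trans (cover (toElement u′) (toElement u) u′⋖u)
      (cong suc (rank-toElement k u′ (ℕ.suc-injective (≡.trans (≡.sym eq) e))))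
    where
    strict : ∀ a b → toElement a < toElement b → rank a ℕ.< rank b
    strict a b (a≤b , a≢b) with rank-strict a b (≤⇒leq a b a≤b)
    ... | inj₁ a≡b = contradiction (cong toElement a≡b) a≢b
    ... | inj₂ a<b = a<b
    u′≢u : toElement u′ ≢ toElement u
    u′≢u d = ℕ.1+n≢n (≡.trans (≡.sym eq) (cong rank (≡.sym (toElement-injective u′ u d))))
    none : ∀ c → ¬ (toElement u′ < c × c < toElement u)
    none c (u′<c , c<u) = ℕ.<⇒≱
      (strict u′ (encode c) (subst (toElement u′ <_) (≡.sym (toElement-encode c)) u′<c))
      (ℕ.≤-pred (subst (rank (encode c) ℕ.<_) eq
        (strict (encode c) u (subst (_< toElement u) (≡.sym (toElement-encode c)) c<u))))
    u′⋖u : toElement u′ ⋖ toElement u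
    u′⋖u = (leq⇒≤ u′ u le , u′≢u) , none

  open CommutativeRing ℤ[x,y]-ring renaming (Carrier to A)
  open Relation.Binary.Reasoning.Setoid setoid
  open ListSum ℤ[x,y]-ring
  open MöbiusInversion ℤ[x,y]-ring constants P

  sum-toElement : ∀ f → sumOver elements f ≈ sumOver allCodes (f ∘ toElement)
  sum-toElement f = begin
    sumOver elements f
      ≈⟨ sum-unique unique (Unique.map⁺ (λ {u} {v} → toElement-injective u v) allCodes-unique)
           complete (λ v → subst (_∈ List.map toElement allCodes) (toElement-encode v)
                             (∈.∈-map⁺ toElement (allCodes-complete (encode v)))) f ⟩
    sumOver (List.map toElement allCodes) f
      ≈⟨ sum-map toElement allCodes f ⟩
    sumOver allCodes (f ∘ toElement) ∎

  -- Exchanging the sums makes the inner sum the Möbius transform of `x ^ rk u`; the hypothesis says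
  -- that `g` solves the system whose only solution is that transform.
  M-triangle-codes : (g : C → A) →
    (∀ v → sumOver allCodes (λ u → g u when leq u v) ≈ x ^ rank v) →
    M-triangle P rk ≈ sumOver allCodes (λ u → g u * y ^ rank u)
  M-triangle-codes g g-sum = begin
    sumOver elements (λ u → sumOver elements λ v → con (μ u v) * x ^ rk u * y ^ rk v)
      ≈⟨ sum-swap elements elements _ ⟩
    sumOver elements (λ v → sumOver elements λ u → con (μ u v) * x ^ rk u * y ^ rk v)
      ≈⟨ sum-cong elements (λ v → trans (sym (sum-* elements (λ u → con (μ u v) * x ^ rk u) (y ^ rk v)))
           (*-congʳ (inversion (g ∘ encode) (λ u → x ^ rk u) sum-below v))) ⟩
    sumOver elements (λ v → g (encode v) * y ^ rk v)
      ≈⟨ sum-toElement _ ⟩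
    sumOver allCodes (λ u → g (encode (toElement u)) * y ^ rk (toElement u))
      ≈⟨ sum-cong allCodes (λ u → reflexive (≡.cong₂ (λ u k → g u * y ^ k)
           (encode-toElement u) (rank-toElement (rank u) u ≡.refl))) ⟩
    sumOver allCodes (λ u → g u * y ^ rank u) ∎
    where
    sum-below : ∀ w → sumBelow w (g ∘ encode) ≈ x ^ rk w
    sum-below w = subst (λ w → sumBelow w (g ∘ encode) ≈ x ^ rk w) (toElement-encode w) (begin
      sumBelow (toElement v) (g ∘ encode)
        ≈⟨ sum-toElement _ ⟩
      sumOver allCodes (λ u → g (encode (toElement u)) when does (toElement u ≤? toElement v))
        ≈⟨ sum-cong allCodes (λ u → reflexive
             (≡.cong₂ (λ u b → g u when b) (encode-toElement u) (does-≤? u v))) ⟩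
      sumOver allCodes (λ u → g u when leq u v)
        ≈⟨ g-sum v ⟩
      x ^ rank v
        ≡⟨ cong (x ^_) (rank-toElement (rank v) v ≡.refl) ⟨
      x ^ rk (toElement v) ∎)
      where v = encode w

open ≡ using (refl; sym; trans)

-- Core labels of the Hochschild lattice

module Letters where

  ≤0 : ∀ {a : Fin 3} → a Fin.≤ (Fin.zero {2}) → a ≡ 0F
  ≤0 {0F} _ = refl

  2≤ : ∀ {a : Fin 3} → Fin.suc (Fin.suc (Fin.zero {0})) Fin.≤ a → a ≡ 2F
  2≤ {1F} (ℕ.s≤s ())
  2≤ {2F} _ = refl

  1≤ : ∀ {a : Fin 3} → a ≢ 0F → Fin.suc (Fin.zero {1}) Fin.≤ a
  1≤ {0F} a≢0 = contradiction refl a≢0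
  1≤ {1F} _ = ℕ.s≤s ℕ.z≤n
  1≤ {2F} _ = ℕ.s≤s ℕ.z≤n

  1≤⇒≢0 : ∀ {a : Fin 3} → Fin.suc (Fin.zero {1}) Fin.≤ a → a ≢ 0F
  1≤⇒≢0 () refl

  ≤2 : ∀ {a : Fin 3} → a Fin.≤ Fin.suc (Fin.suc (Fin.zero {0}))
  ≤2 {0F} = ℕ.z≤n
  ≤2 {1F} = ℕ.s≤s ℕ.z≤n
  ≤2 {2F} = ℕ.s≤s (ℕ.s≤s ℕ.z≤n)

  ≢0,1⇒2 : ∀ {a : Fin 3} → a ≢ 0F → a ≢ 1F → a ≡ 2F
  ≢0,1⇒2 {0F} a≢0 _ = contradiction refl a≢0
  ≢0,1⇒2 {1F} _ a≢1 = contradiction refl a≢1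
  ≢0,1⇒2 {2F} _ _   = refl

  ≢1,2⇒0 : ∀ {a : Fin 3} → a ≢ 1F → a ≢ 2F → a ≡ 0F
  ≢1,2⇒0 {0F} _ _   = refl
  ≢1,2⇒0 {1F} a≢1 _ = contradiction refl a≢1
  ≢1,2⇒0 {2F} _ a≢2 = contradiction refl a≢2

  ≤1,≢1⇒0 : ∀ {a : Fin 3} → a Fin.≤ Fin.suc (Fin.zero {1}) → a ≢ 1F → a ≡ 0F
  ≤1,≢1⇒0 {0F} _ _   = refl
  ≤1,≢1⇒0 {1F} _ a≢1 = contradiction refl a≢1
  ≤1,≢1⇒0 {2F} (ℕ.s≤s ()) _

open Letters

if-yes : ∀ {P A : Set} (d : Dec P) {a b : A} → P → (if does d then a else b) ≡ a
if-yes (yes _) p = refl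
if-yes (no ¬p) p = contradiction p ¬p

if-no : ∀ {P A : Set} (d : Dec P) {a b : A} → ¬ P → (if does d then a else b) ≡ b
if-no (yes p) ¬p = contradiction p ¬p
if-no (no _)  ¬p = refl

NoOne : ∀ {m} → Vec (Fin 3) m → Set
NoOne w = ∀ i → lookup w i ≢ 1F

NoOneAfterZero : ∀ {m} → Vec (Fin 3) m → Set
NoOneAfterZero w = ∀ {i j} → i Fin.< j → lookup w i ≡ 0F → lookup w j ≢ 1F

-- For a triword with first letter 1, these are the positions from its last 1
-- up to, but excluding, its first 0; otherwise there are none.
InBlock : ∀ {m} → Vec (Fin 3) m → Fin m → Set
InBlock w i = (∀ j → j Fin.≤ i → lookup w j ≢ 0F) × (∀ j → i Fin.< j → lookup w j ≢ 1F)

module HochschildLabels (n : ℕ) where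

  open FiniteSemidistributiveLattice (Hoch n)

  infixl 9 _‼_
  _‼_ : Triword n → Fin n → Fin 3
  u ‼ i = lookup (word u) i

  T2 : ∀ u {i} → toℕ i ≡ 0 → u ‼ i ≢ 2F
  T2 u = IsTriword.T2 (isTriword u)

  T3 : ∀ u {i j} → i Fin.< j → u ‼ i ≡ 0F → u ‼ j ≢ 1F
  T3 u = IsTriword.T3 (isTriword u)

  ≤-ext : ∀ u v → (∀ i → u ‼ i Fin.≤ v ‼ i) → u ≤ v
  ≤-ext _ _ = ext

  ≡-ext : ∀ {u v} → (∀ i → u ‼ i ≡ v ‼ i) → u ≡ v
  ≡-ext {u} {v} e = antisym {u} {v} (≤-ext u v (Fin.≤-reflexive ∘ e)) (≤-ext v u (Fin.≤-reflexive ∘ sym ∘ e))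

  ∨-eq : ∀ {u v w} → u ≤ w → v ≤ w → (∀ i → w ‼ i ≡ u ‼ i ⊎ w ‼ i ≡ v ‼ i) → u ∨ v ≡ w
  ∨-eq {u} {v} {w} u≤w v≤w e = antisym {u ∨ v} {w} (∨-least {u} {v} {w} u≤w v≤w) (≤-ext w (u ∨ v) λ i →
    [ (λ eᵤ → subst (Fin._≤ (u ∨ v) ‼ i) (sym eᵤ) (app (x≤x∨y u v) i))
    , (λ eᵥ → subst (Fin._≤ (u ∨ v) ‼ i) (sym eᵥ) (app (y≤x∨y u v) i)) ]′ (e i))

  ∨-split : ∀ {u v w} → u ∨ v ≡ w → ∀ i → w ‼ i ≡ u ‼ i ⊎ w ‼ i ≡ v ‼ i
  ∨-split {u} {v} refl i = [ (λ s → inj₁ (trans l s)) , (λ s → inj₂ (trans l s)) ]′ (⊔-sel (u ‼ i) (v ‼ i))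
    where
    open import Algebra.Construct.NaturalChoice.Max (Fin.≤-totalOrder 3) using (⊔-sel)
    l = TriwordLattice.lookup-⊔ {n} i (word u) (word v)

  module TwoAt (i : Fin n) where

    letter : Fin n → Fin 3
    letter j = if does (j Fin.≟ i) then 2F else 0F

    on : lookup (tabulate letter) i ≡ 2F
    on = trans (Vec.lookup∘tabulate letter i) (if-yes (i Fin.≟ i) refl)

    off : ∀ {j} → j ≢ i → lookup (tabulate letter) j ≡ 0F
    off {j} j≢i = trans (Vec.lookup∘tabulate letter j) (if-no (j Fin.≟ i) j≢i)

  twoAt : (i : Fin n) → toℕ i ≢ 0 → Triword n
  twoAt i i≢0 = ⟨ tabulate letter , record { T2 = t2 ; T3 = λ _ _ → no-1 } ⟩
    where
    open TwoAt i
    t2 : ∀ {j} → toℕ j ≡ 0 → lookup (tabulate letter) j ≢ 2F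
    t2 {j} j≡0 = case j Fin.≟ i of λ where
      (yes refl) _ → i≢0 j≡0
      (no j≢i)   e → Fin.0≢1+n (trans (sym (off j≢i)) e)
    no-1 : ∀ {j} → lookup (tabulate letter) j ≢ 1F
    no-1 {j} e = case j Fin.≟ i of λ where
      (yes refl) → Fin.0≢1+n (Fin.suc-injective (trans (sym e) on))
      (no j≢i)   → Fin.0≢1+n (trans (sym (off j≢i)) e)

  twoAt-on : ∀ i (i≢0 : toℕ i ≢ 0) → twoAt i i≢0 ‼ i ≡ 2F
  twoAt-on i _ = TwoAt.on i

  twoAt-off : ∀ {i j} (i≢0 : toℕ i ≢ 0) → j ≢ i → twoAt i i≢0 ‼ j ≡ 0F
  twoAt-off {i} _ = TwoAt.off i

  twoAt-least : ∀ {i} (i≢0 : toℕ i ≢ 0) {u} → u ‼ i ≡ 2F → twoAt i i≢0 ≤ u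
  twoAt-least {i} i≢0 {u} e = ≤-ext (twoAt i i≢0) u le
    where
    le : ∀ j → twoAt i i≢0 ‼ j Fin.≤ u ‼ j
    le j with j Fin.≟ i
    ... | yes refl = subst (twoAt i i≢0 ‼ i Fin.≤_) (sym e) ≤2
    ... | no j≢i   = subst (Fin._≤ u ‼ j) (sym (twoAt-off i≢0 j≢i)) ℕ.z≤n

  module OnesUpTo (i : Fin n) where

    letter : Fin n → Fin 3
    letter j = if does (j Fin.≤? i) then 1F else 0F

    on : ∀ {j} → j Fin.≤ i → lookup (tabulate letter) j ≡ 1F
    on {j} j≤i = trans (Vec.lookup∘tabulate letter j) (if-yes (j Fin.≤? i) j≤i)

    off : ∀ {j} → ¬ j Fin.≤ i → lookup (tabulate letter) j ≡ 0F
    off {j} j≰i = trans (Vec.lookup∘tabulate letter j) (if-no (j Fin.≤? i) j≰i)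

  onesUpTo : Fin n → Triword n
  onesUpTo i = ⟨ tabulate letter , record { T2 = λ {j} _ → no-2 {j} ; T3 = t3 } ⟩
    where
    open OnesUpTo i
    no-2 : ∀ {j} → lookup (tabulate letter) j ≢ 2F
    no-2 {j} e = case j Fin.≤? i of λ where
      (yes j≤i) → Fin.0≢1+n (Fin.suc-injective (trans (sym (on j≤i)) e))
      (no j≰i)  → Fin.0≢1+n (trans (sym (off j≰i)) e)
    t3 : ∀ {j k} → j Fin.< k → lookup (tabulate letter) j ≡ 0F → lookup (tabulate letter) k ≢ 1F
    t3 {j} {k} j<k ej ek = case k Fin.≤? i of λ where
      (yes k≤i) → Fin.0≢1+n (trans (sym ej) (on (ℕ.≤-trans (ℕ.<⇒≤ j<k) k≤i)))
      (no k≰i)  → Fin.0≢1+n (trans (sym (off k≰i)) ek)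

  onesUpTo-on : ∀ {i j} → j Fin.≤ i → onesUpTo i ‼ j ≡ 1F
  onesUpTo-on {i} = OnesUpTo.on i

  onesUpTo-off : ∀ {i j} → ¬ j Fin.≤ i → onesUpTo i ‼ j ≡ 0F
  onesUpTo-off {i} = OnesUpTo.off i

  onesUpTo-least : ∀ {i u} → (∀ j → j Fin.≤ i → u ‼ j ≢ 0F) → onesUpTo i ≤ u
  onesUpTo-least {i} {u} nz = ≤-ext (onesUpTo i) u le
    where
    le : ∀ j → onesUpTo i ‼ j Fin.≤ u ‼ j
    le j with j Fin.≤? i
    ... | yes j≤i = subst (Fin._≤ u ‼ j) (sym (onesUpTo-on j≤i)) (1≤ (nz j j≤i))
    ... | no j≰i  = subst (Fin._≤ u ‼ j) (sym (onesUpTo-off j≰i)) ℕ.z≤n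

  nonzero-upTo : ∀ {u i} → u ‼ i ≡ 1F → ∀ j → j Fin.≤ i → u ‼ j ≢ 0F
  nonzero-upTo {u} {i} e j j≤i z with Fin.<-cmp j i
  ... | tri< j<i _ _  = T3 u j<i z e
  ... | tri≈ _ refl _ = Fin.0≢1+n (trans (sym z) e)
  ... | tri> _ _ i<j  = ℕ.<⇒≱ i<j j≤i

  -- The lower cover obtained by lowering a single entry need not lower it to
  -- the value given, but it agrees with the word elsewhere.
  lower-cover-at : ∀ u i a → IsTriword (word u [ i ]≔ a) → a Fin.< u ‼ i →
    ∃[ p ] (p ⋖ u × (∀ j → j ≢ i → p ‼ j ≡ u ‼ j) × p ‼ i ≢ u ‼ i)
  lower-cover-at u i a t a<uᵢ = p , p⋖u , agree , differ
    where
    w : Triword n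
    w = ⟨ word u [ i ]≔ a , t ⟩
    w-off : ∀ j → j ≢ i → w ‼ j ≡ u ‼ j
    w-off j j≢i = Vec.lookup∘update′ j≢i (word u) a
    w-on : w ‼ i ≡ a
    w-on = Vec.lookup∘update i (word u) a
    w≤u : ∀ j → w ‼ j Fin.≤ u ‼ j
    w≤u j with j Fin.≟ i
    ... | yes refl = subst (Fin._≤ u ‼ i) (sym w-on) (ℕ.<⇒≤ a<uᵢ)
    ... | no j≢i   = Fin.≤-reflexive (w-off j j≢i)
    w≢u : w ≢ u
    w≢u e = ℕ.<⇒≢ a<uᵢ (cong toℕ (trans (sym w-on) (cong (_‼ i) e)))
    cover = below-lower-cover {w} {u} (≤-ext w u w≤u , w≢u)
    p = proj₁ cover
    w≤p = proj₁ (proj₂ cover)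
    p⋖u = proj₂ (proj₂ cover)
    p≤u = proj₁ (proj₁ p⋖u)
    agree : ∀ j → j ≢ i → p ‼ j ≡ u ‼ j
    agree j j≢i = Fin.≤-antisym (app p≤u j) (subst (Fin._≤ p ‼ j) (w-off j j≢i) (app w≤p j))
    differ : p ‼ i ≢ u ‼ i
    differ e = proj₂ (proj₁ p⋖u) (≡-ext {p} {u} all)
      where
      all : ∀ j → p ‼ j ≡ u ‼ j
      all j with j Fin.≟ i
      ... | yes refl = e
      ... | no j≢i   = agree j j≢i

  update-isTriword : ∀ u i a → (toℕ i ≡ 0 → a ≢ 2F) →
    (∀ {k} → i Fin.< k → a ≡ 0F → u ‼ k ≢ 1F) →
    (∀ {j} → j Fin.< i → u ‼ j ≡ 0F → a ≢ 1F) → IsTriword (word u [ i ]≔ a)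
  update-isTriword u i a a≢2 after before = record { T2 = t2 ; T3 = t3 }
    where
    w = word u [ i ]≔ a
    on : lookup w i ≡ a
    on = Vec.lookup∘update i (word u) a
    off : ∀ {j} → j ≢ i → lookup w j ≡ u ‼ j
    off j≢i = Vec.lookup∘update′ j≢i (word u) a
    t2 : ∀ {j} → toℕ j ≡ 0 → lookup w j ≢ 2F
    t2 {j} j≡0 e with j Fin.≟ i
    ... | yes refl = a≢2 j≡0 (trans (sym on) e)
    ... | no j≢i   = T2 u j≡0 (trans (sym (off j≢i)) e)
    t3 : ∀ {j k} → j Fin.< k → lookup w j ≡ 0F → lookup w k ≢ 1F
    t3 {j} {k} j<k ej ek with j Fin.≟ i | k Fin.≟ i
    ... | yes refl | yes refl = ℕ.<-irrefl refl j<k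
    ... | yes refl | no k≢i = after j<k (trans (sym on) ej) (trans (sym (off k≢i)) ek)
    ... | no j≢i | yes refl = before j<k (trans (sym (off j≢i)) ej) (trans (sym on) ek)
    ... | no j≢i | no k≢i   = T3 u j<k (trans (sym (off j≢i)) ej) (trans (sym (off k≢i)) ek)

  two⇒≢0 : ∀ u {i} → u ‼ i ≡ 2F → toℕ i ≢ 0
  two⇒≢0 u e i≡0 = T2 u i≡0 e

  -- With a 0 to its left an entry 1 is forbidden, so the 2 has to drop to 0; otherwise it drops to
  -- 1.
  lower-two : ∀ u i → u ‼ i ≡ 2F →
    ∃[ p ] (p ⋖ u × (∀ j → j ≢ i → p ‼ j ≡ u ‼ j) × p ‼ i ≢ u ‼ i)
  lower-two u i e with Fin.any? (λ j → j Fin.<? i ×-dec u ‼ j Fin.≟ 0F)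
  ... | yes (z , z<i , uz≡0) = lower-cover-at u i 0F
    (update-isTriword u i 0F (λ _ ()) (λ i<k _ → T3 u (ℕ.<-trans z<i i<k) uz≡0) (λ _ _ ()))
    (subst (λ a → 1 ℕ.≤ toℕ a) (sym e) (ℕ.s≤s ℕ.z≤n))
  ... | no none = lower-cover-at u i 1F
    (update-isTriword u i 1F (λ _ ()) (λ _ ()) (λ j<i uj≡0 _ → none (_ , j<i , uj≡0)))
    (subst (λ a → 2 ℕ.≤ toℕ a) (sym e) ℕ.≤-refl)

  -- Turning a 1 into a 0 respects (T3) when no 1 follows it.
  lower-one : ∀ u i → u ‼ i ≡ 1F → (∀ j → i Fin.< j → u ‼ j ≢ 1F) →
    ∃[ p ] (p ⋖ u × (∀ j → j ≢ i → p ‼ j ≡ u ‼ j) × p ‼ i ≢ u ‼ i)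
  lower-one u i e last = lower-cover-at u i 0F
    (update-isTriword u i 0F (λ _ ()) (λ {k} i<k _ → last k i<k) (λ _ _ ()))
    (subst (λ a → 1 ℕ.≤ toℕ a) (sym e) (ℕ.s≤s ℕ.z≤n))

  nucleus-≤ : ∀ u → nucleus u ≤ u
  nucleus-≤ u = go (filter (_⋖? u) elements)
    where
    go : ∀ ps → ⋀ ps u ≤ u
    go []       = ≤-refl {u}
    go (p ∷ ps) = ≤-trans {⋀ (p ∷ ps) u} {⋀ ps u} {u} (x∧y≤y p (⋀ ps u)) (go ps)

  nucleus-greatest : ∀ {c u} → c ≤ u → (∀ p → p ⋖ u → c ≤ p) → c ≤ nucleus u
  nucleus-greatest {c} {u} c≤u c≤p = go (filter (_⋖? u) elements) (All.all-filter (_⋖? u) elements)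
    where
    go : ∀ ps → All (_⋖ u) ps → c ≤ ⋀ ps u
    go []       []           = c≤u
    go (p ∷ ps) (p⋖u ∷ ps⋖u) = ∧-greatest {c} {p} {⋀ ps u} (c≤p p p⋖u) (go ps ps⋖u)

  twoAt-label : ∀ {p u i} (i≢0 : toℕ i ≢ 0) → p ≤ u → u ‼ i ≡ 2F →
    (∀ j → j ≢ i → p ‼ j ≡ u ‼ j) → p ‼ i ≢ u ‼ i → IsLabel p u (twoAt i i≢0)
  twoAt-label {p} {u} {i} i≢0 p≤u e agree differ =
    ∨-eq {p} {twoAt i i≢0} {u} p≤u (twoAt-least i≢0 {u} e) side ,
    λ d eq → twoAt-least i≢0 {d} (least d eq)
    where
    side : ∀ j → u ‼ j ≡ p ‼ j ⊎ u ‼ j ≡ twoAt i i≢0 ‼ j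
    side j with j Fin.≟ i
    ... | yes refl = inj₂ (trans e (sym (twoAt-on i i≢0)))
    ... | no j≢i   = inj₁ (sym (agree j j≢i))
    least : ∀ d → p ∨ d ≡ u → d ‼ i ≡ 2F
    least d eq with ∨-split {p} {d} {u} eq i
    ... | inj₁ u≡p = contradiction (sym u≡p) differ
    ... | inj₂ u≡d = trans (sym u≡d) e

  Ψ-twoAt : ∀ {u i} (i≢0 : toℕ i ≢ 0) → u ‼ i ≡ 2F → Ψ u (twoAt i i≢0)
  Ψ-twoAt {u} {i} i≢0 e with p , p⋖u , agree , differ ← lower-two u i e =
    p , u , nucleus-lower p⋖u , p⋖u , ≤-refl {u} ,
    twoAt-label {p} {u} i≢0 (proj₁ (proj₁ p⋖u)) e agree differ

  -- The nucleus lies below a lower cover of `u` that has lost the 2 at `j`.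
  nucleus-two : ∀ u j → u ‼ j ≡ 2F → nucleus u ‼ j ≢ 2F
  nucleus-two u j e with p , p⋖u , _ , differ ← lower-two u j e =
    λ N≡2 → differ (trans (2≤ (subst (Fin._≤ p ‼ j) N≡2 (app (nucleus-lower p⋖u) j))) (sym e))

  nucleus-one : ∀ u k → u ‼ k ≡ 1F → (∀ j → k Fin.< j → u ‼ j ≢ 1F) → nucleus u ‼ k ≡ 0F
  nucleus-one u k e last with p , p⋖u , _ , differ ← lower-one u k e last =
    ≤0 (subst (nucleus u ‼ k Fin.≤_)
         (≤1,≢1⇒0 (subst (p ‼ k Fin.≤_) e (app (proj₁ (proj₁ p⋖u)) k)) (λ p≡1 → differ (trans p≡1 (sym e))))
         (app (nucleus-lower p⋖u) k))

  -- Walk left from `i`: an entry that is neither 0 nor 1 is a 2, so by (T2) it is not the first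
  -- entry, and its left neighbour is again in the block.
  lastOne : ∀ u {i} → InBlock (word u) i →
    ∃[ k ] (k Fin.≤ i × u ‼ k ≡ 1F × (∀ j → k Fin.< j → u ‼ j ≢ 1F))
  lastOne u {i} = go i (Fin.<-wellFounded i)
    where
    go : ∀ i → Acc Fin._<_ i → InBlock (word u) i →
      ∃[ k ] (k Fin.≤ i × u ‼ k ≡ 1F × (∀ j → k Fin.< j → u ‼ j ≢ 1F))
    go i (acc rs) (nz , no1) with u ‼ i Fin.≟ 1F
    ... | yes e = i , ℕ.≤-refl , e , no1
    ... | no ≢1 = descend i refl
      where
      descend : ∀ i′ → i′ ≡ i →
        ∃[ k ] (k Fin.≤ i × u ‼ k ≡ 1F × (∀ j → k Fin.< j → u ‼ j ≢ 1F))
      descend Fin.zero refl = contradiction (≢0,1⇒2 (nz i ℕ.≤-refl) ≢1) (T2 u refl)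
      descend (Fin.suc i₀) refl =
        let k , k≤ , last = go (Fin.inject₁ i₀) (rs i₀<i)
              ((λ j j≤ → nz j (ℕ.≤-trans j≤ (ℕ.<⇒≤ i₀<i))) , no1″)
        in k , ℕ.≤-trans k≤ (ℕ.<⇒≤ i₀<i) , last
        where
        i₀<i : Fin.inject₁ i₀ Fin.< Fin.suc i₀
        i₀<i = ℕ.s≤s (ℕ.≤-reflexive (Fin.toℕ-inject₁ i₀))
        no1″ : ∀ j → Fin.inject₁ i₀ Fin.< j → u ‼ j ≢ 1F
        no1″ j i₀<j with Fin.<-cmp j (Fin.suc i₀)
        ... | tri> _ _ i<j = no1 j i<j
        ... | tri≈ _ refl _ = ≢1
        ... | tri< (ℕ.s≤s j≤i₀) _ _ =
          contradiction (subst (ℕ._< toℕ j) (Fin.toℕ-inject₁ i₀) i₀<j) (ℕ.≤⇒≯ j≤i₀)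

  -- The nucleus is 0 at the last 1 of `u`, which is at or before `i`. To the right of this 0 it
  -- cannot be 1, and it keeps no 2 of `u`.
  nucleus-block : ∀ u {i} → InBlock (word u) i → ∀ j → i Fin.≤ j → nucleus u ‼ j ≡ 0F
  nucleus-block u {i} b j i≤j with k , k≤i , e , no1 ← lastOne u b with Fin.<-cmp k j
  ... | tri> _ _ j<k  = contradiction (ℕ.≤-trans k≤i i≤j) (ℕ.<⇒≱ j<k)
  ... | tri≈ _ refl _ = nucleus-one u k e no1
  ... | tri< k<j _ _ with u ‼ j Fin.≟ 2F
  ...   | yes uj≡2 = ≢1,2⇒0 (T3 (nucleus u) k<j (nucleus-one u k e no1)) (nucleus-two u j uj≡2)
  ...   | no uj≢2  = ≤0 (subst (nucleus u ‼ j Fin.≤_) (≢1,2⇒0 (no1 j k<j) uj≢2) (app (nucleus-≤ u) j))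

  -- The label 1^i has to appear on a cover between the nucleus and `u`, but `u` itself may have a 2
  -- at `i`. Clearing everything after `i` and putting 0 or 1 at `i` gives two words that differ
  -- only there; for `i` in the block both lie in that interval.
  module Cut (u : Triword n) (i : Fin n) (nz : ∀ j → j Fin.≤ i → u ‼ j ≢ 0F) where

    letter : Fin 3 → Fin n → Fin 3
    letter a j = if does (j Fin.<? i) then u ‼ j else if does (j Fin.≟ i) then a else 0F

    data View (a : Fin 3) (j : Fin n) : Set where
      below : j Fin.< i → lookup (tabulate (letter a)) j ≡ u ‼ j → View a j
      here  : j ≡ i → lookup (tabulate (letter a)) j ≡ a → View a j
      above : i Fin.< j → lookup (tabulate (letter a)) j ≡ 0F → View a j

    view : ∀ a j → View a j
    view a j = let look = Vec.lookup∘tabulate (letter a) j in case j Fin.<? i of λ where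
      (yes j<i) → below j<i (trans look (if-yes (j Fin.<? i) j<i))
      (no j≮i)  → case j Fin.≟ i of λ where
        (yes j≡i) → here j≡i (trans look (trans (if-no (j Fin.<? i) j≮i) (if-yes (j Fin.≟ i) j≡i)))
        (no j≢i)  → above (ℕ.≤∧≢⇒< (ℕ.≮⇒≥ j≮i) λ e → j≢i (sym (Fin.toℕ-injective e)))
                      (trans look (trans (if-no (j Fin.<? i) j≮i) (if-no (j Fin.≟ i) j≢i)))

    cut : ∀ a → a ≢ 2F → Triword n
    cut a a≢2 = ⟨ tabulate (letter a) , record { T2 = t2 ; T3 = t3 } ⟩
      where
      t2 : ∀ {j} → toℕ j ≡ 0 → lookup (tabulate (letter a)) j ≢ 2F
      t2 {j} j≡0 e with view a j
      ... | below _ l = T2 u j≡0 (trans (sym l) e)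
      ... | here _ l  = a≢2 (trans (sym l) e)
      ... | above _ l = Fin.0≢1+n (trans (sym l) e)
      t3 : ∀ {j k} → j Fin.< k → lookup (tabulate (letter a)) j ≡ 0F → lookup (tabulate (letter a)) k ≢ 1F
      t3 {j} {k} j<k ej ek with view a j | view a k
      ... | below j<i l | _            = nz j (ℕ.<⇒≤ j<i) (trans (sym l) ej)
      ... | _           | above _ l    = Fin.0≢1+n (trans (sym l) ek)
      ... | here refl _ | below k<i _  = ℕ.<-asym j<k k<i
      ... | here refl _ | here refl _  = ℕ.<-irrefl refl j<k
      ... | above i<j _ | below k<i _  = ℕ.<-asym j<k (ℕ.<-trans k<i i<j)
      ... | above i<j _ | here refl _  = ℕ.<-asym j<k i<j

    cut₀ cut₁ : Triword n
    cut₀ = cut 0F λ ()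
    cut₁ = cut 1F λ ()

    at-i : ∀ a a≢2 → cut a a≢2 ‼ i ≡ a
    at-i a _ with view a i
    ... | below i<i _ = contradiction refl (ℕ.<⇒≢ i<i)
    ... | here _ l    = l
    ... | above i<i _ = contradiction refl (ℕ.<⇒≢ i<i)

    agree : ∀ j → j ≢ i → cut₀ ‼ j ≡ cut₁ ‼ j
    agree j j≢i with view 0F j | view 1F j
    ... | here j≡i _  | _           = contradiction j≡i j≢i
    ... | _           | here j≡i _  = contradiction j≡i j≢i
    ... | below _ l   | below _ l′  = trans l (sym l′)
    ... | above _ l   | above _ l′  = trans l (sym l′)
    ... | below j<i _ | above i<j _ = contradiction i<j (ℕ.<-asym j<i)
    ... | above i<j _ | below j<i _ = contradiction i<j (ℕ.<-asym j<i)

    cut₁-≤ : cut₁ ≤ u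
    cut₁-≤ = ≤-ext cut₁ u le
      where
      le : ∀ j → cut₁ ‼ j Fin.≤ u ‼ j
      le j with view 1F j
      ... | below _ l   = Fin.≤-reflexive l
      ... | here refl l = subst (Fin._≤ u ‼ i) (sym l) (1≤ (nz i ℕ.≤-refl))
      ... | above _ l   = subst (Fin._≤ u ‼ j) (sym l) ℕ.z≤n

    cut₀-< : cut₀ < cut₁
    cut₀-< = ≤-ext cut₀ cut₁ le , λ e →
      Fin.0≢1+n (trans (sym (at-i 0F λ ())) (trans (cong (_‼ i) e) (at-i 1F λ ())))
      where
      le : ∀ j → cut₀ ‼ j Fin.≤ cut₁ ‼ j
      le j with j Fin.≟ i
      ... | yes refl = subst (Fin._≤ cut₁ ‼ i) (sym (at-i 0F λ ())) ℕ.z≤n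
      ... | no j≢i   = Fin.≤-reflexive (agree j j≢i)

    cut₀-≥ : (∀ j → i Fin.≤ j → nucleus u ‼ j ≡ 0F) → nucleus u ≤ cut₀
    cut₀-≥ N≡0 = ≤-ext (nucleus u) cut₀ le
      where
      le : ∀ j → nucleus u ‼ j Fin.≤ cut₀ ‼ j
      le j with view 0F j
      ... | below _ l   = subst (nucleus u ‼ j Fin.≤_) (sym l) (app (nucleus-≤ u) j)
      ... | here refl _ = subst (Fin._≤ cut₀ ‼ i) (sym (N≡0 i ℕ.≤-refl)) ℕ.z≤n
      ... | above i<j _ = subst (Fin._≤ cut₀ ‼ j) (sym (N≡0 j (ℕ.<⇒≤ i<j))) ℕ.z≤n

  -- Any `d` that completes the join has the 1 at `i`, and (T3) then makes it nonzero everywhere to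
  -- the left.
  onesUpTo-label : ∀ {p u i} → p ≤ u → u ‼ i ≡ 1F →
    (∀ j → j ≢ i → p ‼ j ≡ u ‼ j) → p ‼ i ≢ u ‼ i → IsLabel p u (onesUpTo i)
  onesUpTo-label {p} {u} {i} p≤u e agree differ =
    ∨-eq {p} {onesUpTo i} {u} p≤u (onesUpTo-least {i} {u} (nonzero-upTo {u} e)) side ,
    λ d eq → onesUpTo-least {i} {d} (nonzero-upTo {d} (least d eq))
    where
    side : ∀ j → u ‼ j ≡ p ‼ j ⊎ u ‼ j ≡ onesUpTo i ‼ j
    side j with j Fin.≟ i
    ... | yes refl = inj₂ (trans e (sym (onesUpTo-on {i} {i} ℕ.≤-refl)))
    ... | no j≢i   = inj₁ (sym (agree j j≢i))
    least : ∀ d → p ∨ d ≡ u → d ‼ i ≡ 1F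
    least d eq with ∨-split {p} {d} {u} eq i
    ... | inj₁ u≡p = contradiction (sym u≡p) differ
    ... | inj₂ u≡d = trans (sym u≡d) e

  Ψ-onesUpTo : ∀ {u i} → InBlock (word u) i → Ψ u (onesUpTo i)
  Ψ-onesUpTo {u} {i} b@(nz , _) =
    let open Cut u i nz
        p , cut₀≤p , p⋖cut₁ = below-lower-cover {cut₀} {cut₁} cut₀-<
        (p≤cut₁ , p≢cut₁) , _ = p⋖cut₁
        agree′ = λ j j≢i → Fin.≤-antisym (app p≤cut₁ j)
          (subst (Fin._≤ p ‼ j) (agree j j≢i) (app cut₀≤p j))
    in p , cut₁ , ≤-trans {nucleus u} {cut₀} {p} (cut₀-≥ (nucleus-block u b)) cut₀≤p ,
       p⋖cut₁ , cut₁-≤ ,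
       onesUpTo-label {p} {cut₁} p≤cut₁ (at-i 1F λ ()) agree′ λ e → p≢cut₁ (≡-ext {p} {cut₁} λ j →
         case j Fin.≟ i of λ where
           (yes refl) → e
           (no j≢i)   → agree′ j j≢i)

  cover-join : ∀ {a b c} → b ⋖ c → a ≤ c → ¬ a ≤ b → b ∨ a ≡ c
  cover-join {a} {b} {c} ((b≤c , _) , cover) a≤c a≰b = decidable-stable (b ∨ a ≟ c) λ ≢c →
    cover (b ∨ a) ((x≤x∨y b a , λ e → a≰b (subst (a ≤_) (sym e) (y≤x∨y b a))) ,
                   (∨-least {b} {a} {c} b≤c a≤c , ≢c))

  -- If a lower cover `p` were 0 at some `k ≤ i`, its join with 1^k would be `u`. But at `j` the
  -- word `p` is not 1, by (T3), and 1^k is 0. Hence 1^i lies below every lower cover, and so below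
  -- the nucleus.
  nucleus-nonzero : ∀ {u i j} → i Fin.< j → u ‼ j ≡ 1F → nucleus u ‼ i ≢ 0F
  nucleus-nonzero {u} {i} {j} i<j e =
    1≤⇒≢0 (subst (Fin._≤ nucleus u ‼ i) (onesUpTo-on {i} {i} ℕ.≤-refl) (app onesUpTo≤N i))
    where
    nz : ∀ k → k Fin.≤ i → u ‼ k ≢ 0F
    nz k k≤i = nonzero-upTo {u} e k (ℕ.≤-trans k≤i (ℕ.<⇒≤ i<j))

    cover-nonzero : ∀ p → p ⋖ u → ∀ k → k Fin.≤ i → p ‼ k ≢ 0F
    cover-nonzero p p⋖u k k≤i z = [ left , right ]′ (∨-split {p} {onesUpTo k} {u} join j)
      where
      k<j = ℕ.≤-<-trans k≤i i<j
      join : p ∨ onesUpTo k ≡ u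
      join = cover-join {onesUpTo k} {p} {u} p⋖u
        (onesUpTo-least {k} {u} λ l l≤k → nz l (ℕ.≤-trans l≤k k≤i))
        (λ le → 1≤⇒≢0 (subst (Fin._≤ p ‼ k) (onesUpTo-on {k} {k} ℕ.≤-refl) (app le k)) z)
      left : u ‼ j ≢ p ‼ j
      left u≡p = T3 p k<j z (trans (sym u≡p) e)
      right : u ‼ j ≢ onesUpTo k ‼ j
      right u≡o = Fin.0≢1+n (trans (sym (onesUpTo-off (ℕ.<⇒≱ k<j))) (trans (sym u≡o) e))

    onesUpTo≤N : onesUpTo i ≤ nucleus u
    onesUpTo≤N = nucleus-greatest {onesUpTo i} {u} (onesUpTo-least {i} {u} nz)
      λ p p⋖u → onesUpTo-least {i} {p} (cover-nonzero p p⋖u)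

  data Label (u c : Triword n) : Set where
    two : ∀ i i≢0 → u ‼ i ≡ 2F → c ≡ twoAt i i≢0 → Label u c
    one : ∀ i → InBlock (word u) i → c ≡ onesUpTo i → Label u c

  -- A cover either creates a 2 at some `i` or, failing that, turns a 0 into a 1. The candidate
  -- label joins `b` to `b′` because nothing lies between them, and it lies below `c` because only
  -- `c` can supply the new entry. In the second case `b`, and with it the nucleus, is 0 at `i`, so
  -- `nucleus-nonzero` excludes a 1 of `u` further right.
  Ψ-label : ∀ {u c} → Ψ u c → Label u c
  Ψ-label {u} {c} (b , b′ , N≤b , b⋖b′@((b≤b′ , b≢b′) , _) , b′≤u , b∨c≡b′ , least)
    with Fin.any? (λ i → b′ ‼ i Fin.≟ 2F ×-dec ¬? (b ‼ i Fin.≟ 2F))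
  ... | yes (i , b′≡2 , b≢2) =
    two i i≢0 (2≤ (subst (Fin._≤ u ‼ i) b′≡2 (app b′≤u i))) (antisym {c} {a} (least a join) a≤c)
    where
    i≢0 = two⇒≢0 b′ b′≡2
    a = twoAt i i≢0
    join : b ∨ a ≡ b′
    join = cover-join {a} {b} {b′} b⋖b′ (twoAt-least i≢0 {b′} b′≡2)
      λ a≤b → b≢2 (2≤ (subst (Fin._≤ b ‼ i) (twoAt-on i i≢0) (app a≤b i)))
    a≤c : a ≤ c
    a≤c = twoAt-least i≢0 {c} ([ (λ e → contradiction (trans (sym e) b′≡2) b≢2)
                               , (λ e → trans (sym e) b′≡2) ]′ (∨-split {b} {c} {b′} b∨c≡b′ i))
  ... | no ∄2 with Fin.any? (λ i → ¬? (b ‼ i Fin.≟ b′ ‼ i))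
  ...   | no ∄≢ = contradiction (≡-ext {b} {b′} λ i → decidable-stable (b ‼ i Fin.≟ b′ ‼ i) λ ≢ → ∄≢ (i , ≢)) b≢b′
  ...   | yes (i , bᵢ≢b′ᵢ) =
    one i ((λ j j≤i → 1≤⇒≢0 (ℕ.≤-trans (1≤ (nonzero-upTo {b′} b′≡1 j j≤i)) (app b′≤u j))) ,
           (λ j i<j u≡1 → nucleus-nonzero {u} i<j u≡1 (≤0 (subst (nucleus u ‼ i Fin.≤_) b≡0 (app N≤b i)))))
        (antisym {c} {a} (least a join) a≤c)
    where
    a = onesUpTo i
    b′≢2 : b′ ‼ i ≢ 2F
    b′≢2 e = ∄2 (i , e , λ e′ → bᵢ≢b′ᵢ (trans e′ (sym e)))
    b′≢0 : b′ ‼ i ≢ 0F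
    b′≢0 e = bᵢ≢b′ᵢ (trans (≤0 (subst (b ‼ i Fin.≤_) e (app b≤b′ i))) (sym e))
    b′≡1 : b′ ‼ i ≡ 1F
    b′≡1 = decidable-stable (b′ ‼ i Fin.≟ 1F) λ ≢1 → b′≢2 (≢0,1⇒2 b′≢0 ≢1)
    b≡0 : b ‼ i ≡ 0F
    b≡0 = ≤1,≢1⇒0 (subst (b ‼ i Fin.≤_) b′≡1 (app b≤b′ i)) λ e → bᵢ≢b′ᵢ (trans e (sym b′≡1))
    join : b ∨ a ≡ b′
    join = cover-join {a} {b} {b′} b⋖b′ (onesUpTo-least {i} {b′} (nonzero-upTo {b′} b′≡1))
      λ a≤b → 1≤⇒≢0 (subst (Fin._≤ b ‼ i) (onesUpTo-on {i} {i} ℕ.≤-refl) (app a≤b i)) b≡0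
    a≤c : a ≤ c
    a≤c = onesUpTo-least {i} {c} (nonzero-upTo {c} ([ (λ e → contradiction (sym e) bᵢ≢b′ᵢ)
                               , (λ e → trans (sym e) b′≡1) ]′ (∨-split {b} {c} {b′} b∨c≡b′ i)))

  twoAt-injective : ∀ {i j} i≢0 j≢0 → twoAt i i≢0 ≡ twoAt j j≢0 → i ≡ j
  twoAt-injective {i} {j} i≢0 j≢0 e = decidable-stable (i Fin.≟ j) λ i≢j →
    Fin.0≢1+n (trans (sym (twoAt-off j≢0 i≢j)) (trans (cong (_‼ i) (sym e)) (twoAt-on i i≢0)))

  onesUpTo-injective : ∀ {i j} → onesUpTo i ≡ onesUpTo j → i ≡ j
  onesUpTo-injective e = Fin.≤-antisym (half e) (half (sym e))
    where
    half : ∀ {i j} → onesUpTo i ≡ onesUpTo j → i Fin.≤ j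
    half {i} {j} e = decidable-stable (i Fin.≤? j) λ i≰j → Fin.0≢1+n
      (trans (sym (onesUpTo-off i≰j)) (trans (cong (_‼ i) (sym e)) (onesUpTo-on {i} {i} ℕ.≤-refl)))

  onesUpTo≢twoAt : ∀ {i j} j≢0 → onesUpTo i ≢ twoAt j j≢0
  onesUpTo≢twoAt {i} {j} j≢0 e with j Fin.≤? i
  ... | yes j≤i = Fin.0≢1+n (Fin.suc-injective
        (trans (sym (onesUpTo-on j≤i)) (trans (cong (_‼ j) e) (twoAt-on j j≢0))))
  ... | no j≰i = Fin.0≢1+n (trans (sym (onesUpTo-off j≰i)) (trans (cong (_‼ j) e) (twoAt-on j j≢0)))

  label-two : ∀ {v i i≢0} → Label v (twoAt i i≢0) → v ‼ i ≡ 2F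
  label-two {v} {i} {i≢0} (two j j≢0 e c≡) = subst (λ k → v ‼ k ≡ 2F) (sym (twoAt-injective i≢0 j≢0 c≡)) e
  label-two {i≢0 = i≢0} (one j _ c≡)       = contradiction (sym c≡) (onesUpTo≢twoAt i≢0)

  label-one : ∀ {v i} → Label v (onesUpTo i) → InBlock (word v) i
  label-one (two j j≢0 _ c≡) = contradiction c≡ (onesUpTo≢twoAt j≢0)
  label-one {v} (one j b c≡) = subst (InBlock (word v)) (sym (onesUpTo-injective c≡)) b

  label-Ψ : ∀ {u c} → Label u c → Ψ u c
  label-Ψ {u} (two i i≢0 e c≡) = subst (Ψ u) (sym c≡) (Ψ-twoAt {u} {i} i≢0 e)
  label-Ψ {u} (one i b c≡)     = subst (Ψ u) (sym c≡) (Ψ-onesUpTo {u} {i} b)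

  label-mono : ∀ {u v c} → (∀ i → (u ‼ i ≡ 2F → v ‼ i ≡ 2F) × (InBlock (word u) i → InBlock (word v) i)) →
    Label u c → Label v c
  label-mono f (two i i≢0 e c≡) = two i i≢0 (proj₁ (f i) e) c≡
  label-mono f (one i b c≡)     = one i (proj₂ (f i) b) c≡

  ⊑⇒ : ∀ {u v} → u ⊑ v → ∀ i → (u ‼ i ≡ 2F → v ‼ i ≡ 2F) × (InBlock (word u) i → InBlock (word v) i)
  ⊑⇒ {u} {v} u⊑v i =
    (λ e → label-two {v} {i} {two⇒≢0 u e}
             (Ψ-label {v} {twoAt i (two⇒≢0 u e)} (u⊑v {twoAt i (two⇒≢0 u e)} (Ψ-twoAt {u} {i} (two⇒≢0 u e) e)))) ,
    (λ b → label-one {v} {i} (Ψ-label {v} {onesUpTo i} (u⊑v {onesUpTo i} (Ψ-onesUpTo {u} {i} b))))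

  ⇒⊑ : ∀ {u v} → (∀ i → (u ‼ i ≡ 2F → v ‼ i ≡ 2F) × (InBlock (word u) i → InBlock (word v) i)) → u ⊑ v
  ⇒⊑ {u} {v} f {c} Ψuc = label-Ψ {v} {c} (label-mono {u} {v} {c} f (Ψ-label {u} {c} Ψuc))

-- Triwords as codes

wordFree : ∀ {m} → Vec Bool m → Vec (Fin 3) m
wordFree []          = []
wordFree (false ∷ p) = 0F ∷ wordFree p
wordFree (true  ∷ p) = 2F ∷ wordFree p

wordBlock : ∀ {m} → Block m → Vec (Fin 3) m
wordBlock end     = []
wordBlock (two b) = 2F ∷ wordBlock b
wordBlock (gap p) = 0F ∷ wordFree p

wordMarked : ∀ {m} → Marked m → Vec (Fin 3) m
wordMarked (keep false w) = 1F ∷ wordMarked w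
wordMarked (keep true  w) = 2F ∷ wordMarked w
wordMarked (mark b)       = 1F ∷ wordBlock b

wordCode : ∀ {m} → Code m → Vec (Fin 3) (suc m)
wordCode (plain p) = 0F ∷ wordFree p
wordCode (later w) = 1F ∷ wordMarked w
wordCode (first b) = 1F ∷ wordBlock b

∷-noOne : ∀ {m a} {w : Vec (Fin 3) m} → a ≢ 1F → NoOne w → NoOne (a ∷ w)
∷-noOne a≢1 w≢1 Fin.zero    = a≢1
∷-noOne a≢1 w≢1 (Fin.suc i) = w≢1 i

∷-noOneAfterZero : ∀ {m a} {w : Vec (Fin 3) m} →
  (a ≡ 0F → NoOne w) → NoOneAfterZero w → NoOneAfterZero (a ∷ w)
∷-noOneAfterZero h t {Fin.zero}  {Fin.suc j} _           = λ a≡0 → h a≡0 j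
∷-noOneAfterZero h t {Fin.suc i} {Fin.suc j} (ℕ.s≤s i<j) = t i<j

noOne⇒noOneAfterZero : ∀ {m} (w : Vec (Fin 3) m) → NoOne w → NoOneAfterZero w
noOne⇒noOneAfterZero w w≢1 {_} {j} _ _ = w≢1 j

free-noOne : ∀ {m} (p : Vec Bool m) → NoOne (wordFree p)
free-noOne (false ∷ p) = ∷-noOne (λ ()) (free-noOne p)
free-noOne (true  ∷ p) = ∷-noOne (λ ()) (free-noOne p)

block-noOne : ∀ {m} (b : Block m) → NoOne (wordBlock b)
block-noOne (two b) = ∷-noOne (λ ()) (block-noOne b)
block-noOne (gap p) = ∷-noOne (λ ()) (free-noOne p)

marked-one : ∀ {m} (w : Marked m) → ¬ NoOne (wordMarked w)
marked-one (keep false w) h = h Fin.zero refl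
marked-one (keep true  w) h = marked-one w (h ∘ Fin.suc)
marked-one (mark b)       h = h Fin.zero refl

marked-noOneAfterZero : ∀ {m} (w : Marked m) → NoOneAfterZero (wordMarked w)
marked-noOneAfterZero (keep false w) = ∷-noOneAfterZero (λ ()) (marked-noOneAfterZero w)
marked-noOneAfterZero (keep true  w) = ∷-noOneAfterZero (λ ()) (marked-noOneAfterZero w)
marked-noOneAfterZero (mark b) = ∷-noOneAfterZero (λ ()) (noOne⇒noOneAfterZero (wordBlock b) (block-noOne b))

code-noOneAfterZero : ∀ {m} (u : Code m) → NoOneAfterZero (wordCode u)
code-noOneAfterZero (plain p) = noOne⇒noOneAfterZero (0F ∷ wordFree p) (∷-noOne (λ ()) (free-noOne p))
code-noOneAfterZero (later w) = ∷-noOneAfterZero (λ ()) (marked-noOneAfterZero w)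
code-noOneAfterZero (first b) = ∷-noOneAfterZero (λ ()) (noOne⇒noOneAfterZero (wordBlock b) (block-noOne b))

code-head : ∀ {m} (u : Code m) {i} → toℕ i ≡ 0 → lookup (wordCode u) i ≢ 2F
code-head (plain _) {Fin.zero} _ ()
code-head (later _) {Fin.zero} _ ()
code-head (first _) {Fin.zero} _ ()

decode : ∀ {m} → Code m → Triword (suc m)
decode u = ⟨ wordCode u , record { T2 = code-head u ; T3 = code-noOneAfterZero u } ⟩

parseFree : ∀ {m} (w : Vec (Fin 3) m) → NoOne w → ∃[ p ] wordFree p ≡ w
parseFree []       h = [] , refl
parseFree (a ∷ w)  h with parseFree w (h ∘ Fin.suc)
parseFree (0F ∷ w) h | p , refl = false ∷ p , refl
parseFree (1F ∷ w) h | p , refl = contradiction refl (h Fin.zero)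
parseFree (2F ∷ w) h | p , refl = true ∷ p , refl

-- The tail is parsed first, and whether it contains a 1 decides how a letter 1 or 2 is attached. A
-- leading 0 allows no 1 after it, so the tail is then read again as a free word.
parse : ∀ {m} (w : Vec (Fin 3) m) → NoOneAfterZero w →
  (∃[ u ] wordMarked u ≡ w) ⊎ (∃[ b ] wordBlock b ≡ w)
parse []      h = inj₂ (end , refl)
parse (a ∷ w) h with parse w (λ {i} {j} i<j → h {Fin.suc i} {Fin.suc j} (ℕ.s≤s i<j))
parse (1F ∷ w) h | inj₁ (u , refl) = inj₁ (keep false u , refl)
parse (2F ∷ w) h | inj₁ (u , refl) = inj₁ (keep true u , refl)
parse (1F ∷ w) h | inj₂ (b , refl) = inj₁ (mark b , refl)
parse (2F ∷ w) h | inj₂ (b , refl) = inj₂ (two b , refl)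
parse (0F ∷ w) h | _ with parseFree w (λ i → h {Fin.zero} {Fin.suc i} (ℕ.s≤s ℕ.z≤n) refl)
... | p , refl = inj₂ (gap p , refl)

triword-≡ : ∀ {n} {u v : Triword n} → word u ≡ word v → u ≡ v
triword-≡ refl = refl

decode-surjective : ∀ {m} (v : Triword (suc m)) → ∃[ u ] decode u ≡ v
decode-surjective {m} v = go (word v) refl
  where
  open IsTriword (isTriword v)
  go : ∀ w → word v ≡ w → ∃[ u ] decode u ≡ v
  go (2F ∷ w) e = contradiction (cong (λ w → lookup w Fin.zero) e) (T2 {Fin.zero} refl)
  go (0F ∷ w) e with parseFree w (λ i wᵢ≡1 → T3 {Fin.zero} {Fin.suc i} (ℕ.s≤s ℕ.z≤n)
      (cong (λ w → lookup w Fin.zero) e) (trans (cong (λ w → lookup w (Fin.suc i)) e) wᵢ≡1))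
  ... | p , refl = plain p , triword-≡ (sym e)
  go (1F ∷ w) e with parse w (λ {i} {j} i<j wᵢ≡0 wⱼ≡1 → T3 {Fin.suc i} {Fin.suc j} (ℕ.s≤s i<j)
      (trans (cong (λ w → lookup w (Fin.suc i)) e) wᵢ≡0)
      (trans (cong (λ w → lookup w (Fin.suc j)) e) wⱼ≡1))
  ... | inj₁ (u , refl) = later u , triword-≡ (sym e)
  ... | inj₂ (b , refl) = first b , triword-≡ (sym e)

-- The core label order on codes

infix 3 _↔′_
_↔′_ : Set → Set → Set
A ↔′ B = (A → B) × (B → A)

HasTwo HasOnes : ∀ {m} → Vec Letter m → Fin m → Set
HasTwo  p i = proj₁ (lookup p i) ≡ true
HasOnes p i = proj₂ (lookup p i) ≡ true

free-two : ∀ {m} (p : Vec Bool m) i → HasTwo (free p) i ↔′ lookup (wordFree p) i ≡ 2F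
free-two (false ∷ p) Fin.zero    = (λ ()) , (λ ())
free-two (true  ∷ p) Fin.zero    = (λ _ → refl) , (λ _ → refl)
free-two (false ∷ p) (Fin.suc i) = free-two p i
free-two (true  ∷ p) (Fin.suc i) = free-two p i

block-two : ∀ {m} (b : Block m) i → HasTwo (blockLetters b) i ↔′ lookup (wordBlock b) i ≡ 2F
block-two (two b) Fin.zero    = (λ _ → refl) , (λ _ → refl)
block-two (gap p) Fin.zero    = (λ ()) , (λ ())
block-two (two b) (Fin.suc i) = block-two b i
block-two (gap p) (Fin.suc i) = free-two p i

marked-two : ∀ {m} (w : Marked m) i → HasTwo (markedLetters w) i ↔′ lookup (wordMarked w) i ≡ 2F
marked-two (keep false w) Fin.zero    = (λ ()) , (λ ())
marked-two (keep true  w) Fin.zero    = (λ _ → refl) , (λ _ → refl)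
marked-two (mark b)       Fin.zero    = (λ ()) , (λ ())
marked-two (keep false w) (Fin.suc i) = marked-two w i
marked-two (keep true  w) (Fin.suc i) = marked-two w i
marked-two (mark b)       (Fin.suc i) = block-two b i

code-two : ∀ {m} (u : Code m) i → HasTwo (letters u) i ↔′ lookup (wordCode u) i ≡ 2F
code-two (plain p) Fin.zero    = (λ ()) , (λ ())
code-two (later w) Fin.zero    = (λ ()) , (λ ())
code-two (first b) Fin.zero    = (λ ()) , (λ ())
code-two (plain p) (Fin.suc i) = free-two p i
code-two (later w) (Fin.suc i) = marked-two w i
code-two (first b) (Fin.suc i) = block-two b i

inBlock-head : ∀ {m a} {w : Vec (Fin 3) m} {i} → InBlock (a ∷ w) i → a ≢ 0F
inBlock-head (h , _) = h Fin.zero ℕ.z≤n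

inBlock-zero : ∀ {m a} {w : Vec (Fin 3) m} → a ≢ 0F → NoOne w → InBlock (a ∷ w) Fin.zero
inBlock-zero a≢0 h = (λ { Fin.zero _ → a≢0 }) , λ { (Fin.suc j) _ → h j }

inBlock-suc : ∀ {m a} {w : Vec (Fin 3) m} {i} → a ≢ 0F → InBlock w i → InBlock (a ∷ w) (Fin.suc i)
inBlock-suc a≢0 (h , t) =
  (λ { Fin.zero _ → a≢0 ; (Fin.suc j) (ℕ.s≤s j≤i) → h j j≤i }) , λ { (Fin.suc j) (ℕ.s≤s i<j) → t j i<j }

inBlock-zero⁻ : ∀ {m a} {w : Vec (Fin 3) m} → InBlock (a ∷ w) Fin.zero → NoOne w
inBlock-zero⁻ (_ , t) j = t (Fin.suc j) (ℕ.s≤s ℕ.z≤n)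

inBlock-suc⁻ : ∀ {m a} {w : Vec (Fin 3) m} {i} → InBlock (a ∷ w) (Fin.suc i) → InBlock w i
inBlock-suc⁻ (h , t) = (λ j j≤i → h (Fin.suc j) (ℕ.s≤s j≤i)) , λ j i<j → t (Fin.suc j) (ℕ.s≤s i<j)

free-ones : ∀ {m} (p : Vec Bool m) i → ¬ HasOnes (free p) i
free-ones (_ ∷ p) (Fin.suc i) = free-ones p i

block-ones : ∀ {m} (b : Block m) i → HasOnes (blockLetters b) i ↔′ InBlock (wordBlock b) i
block-ones (two b) Fin.zero    = (λ _ → inBlock-zero (λ ()) (block-noOne b)) , λ _ → refl
block-ones (two b) (Fin.suc i) =
  inBlock-suc (λ ()) ∘ proj₁ (block-ones b i) , proj₂ (block-ones b i) ∘ inBlock-suc⁻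
block-ones (gap p) Fin.zero    = (λ ()) , λ l → contradiction refl (inBlock-head l)
block-ones (gap p) (Fin.suc i) =
  (λ l → contradiction l (free-ones p i)) , λ l → contradiction refl (inBlock-head l)

marked-ones : ∀ {m} (w : Marked m) i → HasOnes (markedLetters w) i ↔′ InBlock (wordMarked w) i
marked-ones (keep false w) Fin.zero    = (λ ()) , λ l → contradiction (inBlock-zero⁻ l) (marked-one w)
marked-ones (keep true  w) Fin.zero    = (λ ()) , λ l → contradiction (inBlock-zero⁻ l) (marked-one w)
marked-ones (mark b)       Fin.zero    = (λ _ → inBlock-zero (λ ()) (block-noOne b)) , λ _ → refl
marked-ones (keep false w) (Fin.suc i) =
  inBlock-suc (λ ()) ∘ proj₁ (marked-ones w i) , proj₂ (marked-ones w i) ∘ inBlock-suc⁻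
marked-ones (keep true  w) (Fin.suc i) =
  inBlock-suc (λ ()) ∘ proj₁ (marked-ones w i) , proj₂ (marked-ones w i) ∘ inBlock-suc⁻
marked-ones (mark b)       (Fin.suc i) =
  inBlock-suc (λ ()) ∘ proj₁ (block-ones b i) , proj₂ (block-ones b i) ∘ inBlock-suc⁻

code-ones : ∀ {m} (u : Code m) i → HasOnes (letters u) i ↔′ InBlock (wordCode u) i
code-ones (plain p) Fin.zero    = (λ ()) , λ l → contradiction refl (inBlock-head l)
code-ones (plain p) (Fin.suc i) =
  (λ l → contradiction l (free-ones p i)) , λ l → contradiction refl (inBlock-head l)
code-ones (later w) Fin.zero    = (λ ()) , λ l → contradiction (inBlock-zero⁻ l) (marked-one w)
code-ones (later w) (Fin.suc i) =
  inBlock-suc (λ ()) ∘ proj₁ (marked-ones w i) , proj₂ (marked-ones w i) ∘ inBlock-suc⁻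
code-ones (first b) Fin.zero    = (λ _ → inBlock-zero (λ ()) (block-noOne b)) , λ _ → refl
code-ones (first b) (Fin.suc i) =
  inBlock-suc (λ ()) ∘ proj₁ (block-ones b i) , proj₂ (block-ones b i) ∘ inBlock-suc⁻

∧-true : ∀ {a b} → a ∧ b ≡ true → a ≡ true × b ≡ true
∧-true {true} e = refl , e

true-∧ : ∀ {a b} → a ≡ true → b ≡ true → a ∧ b ≡ true
true-∧ refl refl = refl

⇒-elim : ∀ {a b} → (a ⇒ b) ≡ true → a ≡ true → b ≡ true
⇒-elim {true} e _ = e

⇒-intro : ∀ {a b} → (a ≡ true → b ≡ true) → (a ⇒ b) ≡ true
⇒-intro {true}  h = h refl
⇒-intro {false} h = refl

≼-elim : ∀ {m} (p p′ : Vec Letter m) → (p ≼ p′) ≡ true →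
  ∀ i → (HasTwo p i → HasTwo p′ i) × (HasOnes p i → HasOnes p′ i)
≼-elim ((s , t) ∷ p) ((s′ , t′) ∷ p′) e i with ∧-true {s ⇒ s′} e
≼-elim ((s , t) ∷ p) ((s′ , t′) ∷ p′) e i | es , e′ with ∧-true {t ⇒ t′} e′
≼-elim ((s , t) ∷ p) ((s′ , t′) ∷ p′) e Fin.zero    | es , e′ | et , ep = ⇒-elim es , ⇒-elim et
≼-elim ((s , t) ∷ p) ((s′ , t′) ∷ p′) e (Fin.suc i) | es , e′ | et , ep = ≼-elim p p′ ep i

≼-intro : ∀ {m} (p p′ : Vec Letter m) →
  (∀ i → (HasTwo p i → HasTwo p′ i) × (HasOnes p i → HasOnes p′ i)) → (p ≼ p′) ≡ true
≼-intro []      []        h = refl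
≼-intro (_ ∷ p) (_ ∷ p′) h = true-∧ (⇒-intro (proj₁ (h Fin.zero)))
  (true-∧ (⇒-intro (proj₂ (h Fin.zero))) (≼-intro p p′ (h ∘ Fin.suc)))

module _ {m : ℕ} where

  open FiniteSemidistributiveLattice (Hoch (suc m)) using (_⊑_; _⊑?_)
  open HochschildLabels (suc m) using (⊑⇒; ⇒⊑)

  ⊑⇒≼ : ∀ (u v : Code m) → decode u ⊑ decode v → (letters u ≼ letters v) ≡ true
  ⊑⇒≼ u v u⊑v = ≼-intro (letters u) (letters v) λ i →
    let mono₂ , mono₁ = ⊑⇒ {decode u} {decode v} (λ {c} → u⊑v {c}) i in
    proj₂ (code-two v i) ∘ mono₂ ∘ proj₁ (code-two u i) ,
    proj₂ (code-ones v i) ∘ mono₁ ∘ proj₁ (code-ones u i)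

  ≼⇒⊑ : ∀ (u v : Code m) → (letters u ≼ letters v) ≡ true → decode u ⊑ decode v
  ≼⇒⊑ u v e {c} = ⇒⊑ {decode u} {decode v} (λ i →
    let mono₂ , mono₁ = ≼-elim (letters u) (letters v) e i in
    proj₁ (code-two v i) ∘ mono₂ ∘ proj₂ (code-two u i) ,
    proj₁ (code-ones v i) ∘ mono₁ ∘ proj₂ (code-ones u i)) {c}

  does-⊑? : ∀ (u v : Code m) → does (decode u ⊑? decode v) ≡ (letters u ≼ letters v)
  does-⊑? u v = go (decode u ⊑? decode v) (λ u⊑v → ⊑⇒≼ u v λ {c} → u⊑v {c}) (λ e {c} → ≼⇒⊑ u v e {c})
    where
    go : ∀ {P : Set} {b} (d : Dec P) → (P → b ≡ true) → (b ≡ true → P) → does d ≡ b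
    go (yes p) to from = sym (to p)
    go {b = true}  (no ¬p) to from = contradiction (from refl) ¬p
    go {b = false} (no ¬p) to from = refl

-- Strictness of the rank and descent to the bottom

private
  variable
    m : ℕ

≼-refl : (p : Vec Letter m) → (p ≼ p) ≡ true
≼-refl p = ≼-intro p p λ _ → id , id

≼-size : (p p′ : Vec Letter m) → (p ≼ p′) ≡ true → size p ℕ.≤ size p′
≼-size []                []                e = ℕ.z≤n
≼-size ((false , t) ∷ p) ((false , _) ∷ p′) e = ≼-size p p′ (proj₂ (∧-true {t ⇒ _} e))
≼-size ((false , t) ∷ p) ((true  , _) ∷ p′) e = ℕ.m≤n⇒m≤1+n (≼-size p p′ (proj₂ (∧-true {t ⇒ _} e)))
≼-size ((true  , t) ∷ p) ((true  , _) ∷ p′) e = ℕ.s≤s (≼-size p p′ (proj₂ (∧-true {t ⇒ _} e)))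

free-strict : (p p′ : Vec Bool m) → (free p ≼ free p′) ≡ true →
  p ≡ p′ ⊎ size (free p) ℕ.< size (free p′)
free-strict []          []           e = inj₁ refl
free-strict (false ∷ p) (false ∷ p′) e = Sum.map₁ (cong (false ∷_)) (free-strict p p′ e)
free-strict (false ∷ p) (true  ∷ p′) e = inj₂ (ℕ.s≤s (≼-size (free p) (free p′) e))
free-strict (true  ∷ p) (true  ∷ p′) e = Sum.map (cong (true ∷_)) ℕ.s≤s (free-strict p p′ e)

block-strict : (b b′ : Block m) → (blockLetters b ≼ blockLetters b′) ≡ true →
  b ≡ b′ ⊎ size (blockLetters b) ℕ.< size (blockLetters b′)
block-strict end     end      e = inj₁ refl
block-strict (two b) (two b′) e = Sum.map (cong two) ℕ.s≤s (block-strict b b′ e)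
block-strict (gap p) (two b′) e = inj₂ (ℕ.s≤s (≼-size (free p) (blockLetters b′) e))
block-strict (gap p) (gap p′) e = Sum.map₁ (cong gap) (free-strict p p′ e)

-- At the mark the second bit forces a 2 in the block, where the marked tail has a 1; this position
-- makes the inequality strict.
marked-block-strict : (w : Marked m) (b : Block m) → (markedLetters w ≼ blockLetters b) ≡ true →
  size (markedLetters w) ℕ.< size (blockLetters b)
marked-block-strict (keep false w) (two b) e = ℕ.m<n⇒m<1+n (marked-block-strict w b e)
marked-block-strict (keep true  w) (two b) e = ℕ.s≤s (marked-block-strict w b e)
marked-block-strict (keep false w) (gap p) e with () ← trans (sym (marked⋠free w p)) e
marked-block-strict (mark b′)      (two b) e = ℕ.s≤s (≼-size (blockLetters b′) (blockLetters b) e)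

marked-strict : (w w′ : Marked m) → (markedLetters w ≼ markedLetters w′) ≡ true →
  w ≡ w′ ⊎ size (markedLetters w) ℕ.< size (markedLetters w′)
marked-strict (keep false w) (keep false w′) e = Sum.map₁ (cong (keep false)) (marked-strict w w′ e)
marked-strict (keep false w) (keep true  w′) e =
  inj₂ (ℕ.s≤s (≼-size (markedLetters w) (markedLetters w′) e))
marked-strict (keep true  w) (keep true  w′) e =
  Sum.map (cong (keep true)) ℕ.s≤s (marked-strict w w′ e)
marked-strict (keep false w) (mark b)        e = inj₂ (marked-block-strict w b e)
marked-strict (mark b)       (mark b′)       e = Sum.map₁ (cong mark) (block-strict b b′ e)
marked-strict (mark b)       (keep false w′) ()
marked-strict (mark b)       (keep true  w′) ()

code-strict : (u v : Code m) → (letters u ≼ letters v) ≡ true → u ≡ v ⊎ codeRank u ℕ.< codeRank v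
code-strict (plain p) (plain p′) e = Sum.map₁ (cong plain) (free-strict p p′ e)
code-strict (plain p) (later w)  e = inj₂ (ℕ.s≤s (≼-size (free p) (markedLetters w) e))
code-strict (plain p) (first b)  e = inj₂ (ℕ.s≤s (≼-size (free p) (blockLetters b) e))
code-strict (later w) (later w′) e = Sum.map (cong later) ℕ.s≤s (marked-strict w w′ e)
code-strict (later w) (first b)  e = inj₂ (ℕ.s≤s (marked-block-strict w b e))
code-strict (first b) (first b′) e = Sum.map (cong first) ℕ.s≤s (block-strict b b′ e)
code-strict (later w) (plain p)  e with () ← trans (sym (marked⋠free w p)) e

decode-≡⇒≼ : (u v : Code m) → decode u ≡ decode v → (letters u ≼ letters v) ≡ true
decode-≡⇒≼ u v e = ≼-intro (letters u) (letters v) λ i →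
  let e′ = cong word e in
  (λ h → proj₂ (code-two v i) (subst (λ w → lookup w i ≡ 2F) e′ (proj₁ (code-two u i) h))) ,
  (λ h → proj₂ (code-ones v i) (subst (λ w → InBlock w i) e′ (proj₁ (code-ones u i) h)))

-- Equal words have equal label bits, so each code is below the other; if the codes differed, each
-- would have smaller rank than the other.
decode-injective : (u v : Code m) → decode u ≡ decode v → u ≡ v
decode-injective u v e
  with code-strict u v (decode-≡⇒≼ u v e) | code-strict v u (decode-≡⇒≼ v u (sym e))
... | inj₁ u≡v | _        = u≡v
... | inj₂ _   | inj₁ v≡u = sym v≡u
... | inj₂ u<v | inj₂ v<u = contradiction v<u (ℕ.<-asym u<v)

freeTwos : Vec Letter m → Vec Bool m
freeTwos = Vec.map proj₁

freeTwos-≼ : (p : Vec Letter m) → (free (freeTwos p) ≼ p) ≡ true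
freeTwos-≼ []            = refl
freeTwos-≼ ((s , _) ∷ p) = true-∧ (⇒-intro {s} id) (freeTwos-≼ p)

freeTwos-size : (p : Vec Letter m) → size (free (freeTwos p)) ≡ size p
freeTwos-size []                = refl
freeTwos-size ((false , _) ∷ p) = freeTwos-size p
freeTwos-size ((true  , _) ∷ p) = cong suc (freeTwos-size p)

free-lower : (p : Vec Bool m) → (∀ v → (free p ≼ v) ≡ true) ⊎
  ∃[ p′ ] ((free p′ ≼ free p) ≡ true × size (free p) ≡ suc (size (free p′)))
free-lower []          = inj₁ λ { [] → refl }
free-lower (true  ∷ p) = inj₂ (false ∷ p , ≼-refl (free p) , refl)
free-lower (false ∷ p) with free-lower p
... | inj₁ least          = inj₁ λ { (_ ∷ v) → least v }
... | inj₂ (p′ , le , eq) = inj₂ (false ∷ p′ , le , eq)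

-- If a 1 is present, giving up all labels 1^i while keeping the 2s lowers the rank by exactly one.
-- Otherwise some 2 is replaced by a 0, unless there is none.
code-lower : (u : Code m) → (∀ v → (letters u ≼ letters v) ≡ true) ⊎
  ∃[ u′ ] ((letters u′ ≼ letters u) ≡ true × codeRank u ≡ suc (codeRank u′))
code-lower (plain p) with free-lower p
... | inj₁ least          = inj₁ λ { (plain _) → least _ ; (later _) → least _ ; (first _) → least _ }
... | inj₂ (p′ , le , eq) = inj₂ (plain p′ , le , eq)
code-lower (later w) = inj₂ (plain (freeTwos (markedLetters w)) ,
  freeTwos-≼ (markedLetters w) , cong suc (sym (freeTwos-size (markedLetters w))))
code-lower (first b) = inj₂ (plain (freeTwos (blockLetters b)) ,
  freeTwos-≼ (blockLetters b) , cong suc (sym (freeTwos-size (blockLetters b))))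

falses-size : ∀ m → size (free (Vec.replicate m false)) ≡ 0
falses-size zero    = refl
falses-size (suc m) = falses-size m

least-rank : (u : Code m) → (∀ v → (letters u ≼ letters v) ≡ true) → codeRank u ≡ 0
least-rank {m} u least with code-strict u (plain (Vec.replicate m false)) (least (plain (Vec.replicate m false)))
... | inj₁ refl = falses-size m
... | inj₂ u<0    = contradiction (subst (codeRank u ℕ.<_) (falses-size m) u<0) ℕ.n≮0

-- Enumeration of the codes

frees-complete : (p : Vec Bool m) → p ∈ frees m
frees-complete []          = here refl
frees-complete (false ∷ p) = ∈.∈-++⁺ˡ (∈.∈-map⁺ _ (frees-complete p))
frees-complete (true  ∷ p) = ∈.∈-++⁺ʳ (List.map (false ∷_) (frees _)) (∈.∈-map⁺ _ (frees-complete p))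

blocks-complete : (b : Block m) → b ∈ blocks m
blocks-complete end     = here refl
blocks-complete (two b) = ∈.∈-++⁺ˡ (∈.∈-map⁺ _ (blocks-complete b))
blocks-complete (gap p) = ∈.∈-++⁺ʳ (List.map two (blocks _)) (∈.∈-map⁺ _ (frees-complete p))

markeds-complete : (w : Marked m) → w ∈ markeds m
markeds-complete (keep false w) = ∈.∈-++⁺ˡ (∈.∈-map⁺ _ (markeds-complete w))
markeds-complete (keep true  w) = ∈.∈-++⁺ʳ (List.map (keep false) (markeds _))
  (∈.∈-++⁺ˡ (∈.∈-map⁺ _ (markeds-complete w)))
markeds-complete (mark b) = ∈.∈-++⁺ʳ (List.map (keep false) (markeds _))
  (∈.∈-++⁺ʳ (List.map (keep true) (markeds _)) (∈.∈-map⁺ _ (blocks-complete b)))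

codes-complete : (u : Code m) → u ∈ codes m
codes-complete (plain p) = ∈.∈-++⁺ˡ (∈.∈-map⁺ _ (frees-complete p))
codes-complete (later w) = ∈.∈-++⁺ʳ (List.map plain (frees _)) (∈.∈-++⁺ˡ (∈.∈-map⁺ _ (markeds-complete w)))
codes-complete (first b) = ∈.∈-++⁺ʳ (List.map plain (frees _))
  (∈.∈-++⁺ʳ (List.map later (markeds _)) (∈.∈-map⁺ _ (blocks-complete b)))

map-++-unique : ∀ {A B : Set} {h : A → B} {as bs} → (∀ {a a′} → h a ≡ h a′ → a ≡ a′) →
  Unique as → Unique bs → (∀ a → ¬ h a ∈ bs) → Unique (List.map h as ++ bs)
map-++-unique inj uas ubs disjoint = Unique.++⁺ (Unique.map⁺ inj uas) ubs λ (∈as , ∈bs) →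
  let a , _ , e = ∈.∈-map⁻ _ ∈as in disjoint a (subst (_∈ _) e ∈bs)

∉-map : ∀ {A B : Set} {h : A → B} {b as} → (∀ a → b ≢ h a) → ¬ b ∈ List.map h as
∉-map ≢ b∈ = let a , _ , e = ∈.∈-map⁻ _ b∈ in ≢ a e

∉-++ : ∀ {A : Set} {a : A} as {bs} → ¬ a ∈ as → ¬ a ∈ bs → ¬ a ∈ as ++ bs
∉-++ as ∉as ∉bs a∈ = [ ∉as , ∉bs ]′ (∈.∈-++⁻ as a∈)

frees-unique : ∀ m → Unique (frees m)
frees-unique zero    = [] ∷ []
frees-unique (suc m) = map-++-unique (λ { refl → refl }) (frees-unique m)
  (Unique.map⁺ (λ { refl → refl }) (frees-unique m)) λ _ → ∉-map λ _ ()

blocks-unique : ∀ m → Unique (blocks m)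
blocks-unique zero    = [] ∷ []
blocks-unique (suc m) = map-++-unique (λ { refl → refl }) (blocks-unique m)
  (Unique.map⁺ (λ { refl → refl }) (frees-unique m)) λ _ → ∉-map λ _ ()

markeds-unique : ∀ m → Unique (markeds m)
markeds-unique zero    = []
markeds-unique (suc m) = map-++-unique (λ { refl → refl }) (markeds-unique m)
  (map-++-unique (λ { refl → refl }) (markeds-unique m)
    (Unique.map⁺ (λ { refl → refl }) (blocks-unique m)) λ _ → ∉-map λ _ ())
  λ _ → ∉-++ (List.map (keep true) (markeds m)) (∉-map λ _ ()) (∉-map λ _ ())

codes-unique : ∀ m → Unique (codes m)
codes-unique m = map-++-unique (λ { refl → refl }) (frees-unique m)
  (map-++-unique (λ { refl → refl }) (markeds-unique m)
    (Unique.map⁺ (λ { refl → refl }) (blocks-unique m)) λ _ → ∉-map λ _ ())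
  λ _ → ∉-++ (List.map later (markeds m)) (∉-map λ _ ()) (∉-map λ _ ())

-- The M-triangle of the Hochschild lattice

encoding : ∀ m → Encoding (CLO (Hoch (suc m))) (Code m)
encoding m = record
  { toElement            = decode
  ; toElement-surjective = decode-surjective
  ; toElement-injective  = decode-injective
  ; leq               = λ u v → letters u ≼ letters v
  ; does-≤?           = does-⊑?
  ; rank              = codeRank
  ; rank-strict       = code-strict
  ; lower             = λ u → Sum.map₁ (λ least → least , least-rank u least) (code-lower u)
  ; allCodes          = codes m
  ; allCodes-unique   = codes-unique m
  ; allCodes-complete = codes-complete
  }

theorem6p4 : let open CommutativeRing ℤ[x,y]-ring in
    (n : ℕ) → n ℕ.> 0 →
    (rk : Triword n → ℕ) → IsRankFunction (CLO (Hoch n)) rk →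
    (x * y - y + 1#) ^ (2 ∸ n) * M-triangle (CLO (Hoch n)) rk
    ≈ (x * y - y + 1#) ^ (n ∸ 2)
    * (con (+ (n ℕ.+ 1)) * ((x - 1#) * y - x * y ^ 2)
    + (con (+ n) + x ^ 2) * y ^ 2 + 1#)
theorem6p4 (suc m) _ rk isRank =
  R.trans (R.*-congˡ {q ^ (2 ∸ suc m)} (R.trans (M-triangle-codes g sum-codes) (total-codes m))) (total-formula m)
  where
  module R = CommutativeRing ℤ[x,y]-ring
  open RankedEncoding (encoding m) isRank
  open CodeSums ℤ[x,y]-ring constants x y
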